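{- Let $M_1$ and $M_2$ be matroids on disjoint finite sets. The $\mathcal{G}$-invariant of the free product $M_1\mathbin{\Box}M_2$ can be calculated from the $\mathcal{G}$-invariants of $M_1$ and $M_2$; that is, if $M_1',M_2'$ are matroids on disjoint finite sets with $\mathcal{G}(M_1')=\mathcal{G}(M_1)$ and $\mathcal{G}(M_2')=\mathcal{G}(M_2)$, then $\mathcal{G}(M_1'\mathbin{\Box}M_2')=\mathcal{G}(M_1\mathbin{\Box}M_2)$.
   Context: An $(n,r)$-sequence is a $0,1$-sequence of length $n$ with exactly $r$ ones. $\mathcal{G}(n,r)$ is the vector space over a field of characteristic zero with basis the formal symbols $[\underline{r}]$, one for each $(n,r)$-sequence $\underline{r}$. For a rank-$r$ matroid $M$ with rank function $r(\cdot)$ on an $n$-element set $E$, and a permutation (linear ordering) $\pi$ of $E$, the rank sequence $\underline{r}(\pi)=r_1r_2\ldots r_n$ is given by $r_1=r(\{\pi(1)\})$ and $r_j=r(\{\pi(1),\ldots,\pi(j)\})-r(\{\pi(1),\ldots,\pi(j-1)\})$ for $j\ge2$. The $\mathcal{G}$-invariant is $\mathcal{G}(M)=\sum_{\pi}[\underline{r}(\pi)]\in\mathcal{G}(n,r)$, the sum over all $n!$ permutations of $E$. For matroids $M_1,M_2$ of ranks $r_1,r_2$ on disjoint sets $E_1,E_2$, the free product $M_1\mathbin{\Box}M_2$ is the matroid on $E_1\cup E_2$ whose bases are the subsets $B$ of $E_1\cup E_2$ of size $r_1+r_2$ such that $B\cap E_1$ is independent in $M_1$ and $B\cap E_2$ spans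 $M_2$. Its rank function is, for $X_i\subseteq E_i$, $r_{M_1\Box M_2}(X_1\cup X_2)=\min\{r_1(E_1)+r_2(X_2),\;r_1(X_1)+|X_2|\}$, where $r_i(\cdot)$ is the rank function of $M_i$. -}

module Defs where

open import Algebra.Apartness.Bundles using (HeytingField; HeytingCommutativeRing)
open import Algebra.Bundles using (CommutativeRing)
import Algebra.Construct.Pointwise as Pointwise
import Algebra.Definitions.RawMonoid as RawMonoidDefinitions
open import Algebra.Module.Bundles using (Module)
open import Data.Bool.Base using (if_then_else_)
open import Data.Fin.Base using (Fin; zero; suc; toℕ; _↑ˡ_; _↑ʳ_; splitAt; punchIn)
open import Data.Fin.Patterns using (0F)
import Data.Fin.Permutation as Perm
open import Data.Fin.Permutation using (Permutation′; _⟨$⟩ʳ_; _⟨$⟩ˡ_; insert; remove; inverseʳ)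
open import Data.Fin.Properties using (any?; toℕ<n; toℕ-injective; ↑ˡ-injective; ↑ʳ-injective; splitAt⁻¹-↑ˡ; splitAt⁻¹-↑ʳ)
import Data.Fin.Properties as Fin
open import Data.Fin.Subset using (Subset; inside; outside; _∈_; _∉_; _⊆_; _⊂_; _∪_; _─_; _-_; ⁅_⁆; ∣_∣; ⊥; ⊤)
open import Data.Fin.Subset.Properties
open import Data.List.Base using (List; []; _∷_; _++_; map; filter; foldr; allFin; cartesianProductWith; length)
open import Data.List.Extrema.Nat using (max; xs≤max; argmax-sel)
open import Data.List.Membership.Propositional using () renaming (_∈_ to _∈ˡ_)
open import Data.List.Membership.Propositional.Properties using (∈-map⁺; ∈-map⁻; ∈-++⁺ˡ; ∈-++⁺ʳ; ∈-filter⁺; ∈-filter⁻; ∈-cartesianProductWith⁺; ∈-allFin)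
import Data.List.Properties as List
import Data.List.Relation.Unary.All as Allˡ
open import Data.List.Relation.Unary.Any using (here; there)
open import Data.Nat.Base using (ℕ; zero; suc; _+_; _*_; _∸_; _≤_; _<_; z≤n; s≤s; _!; NonZero)
open import Data.Nat.Properties
  using (_≟_; _<?_; ≤-refl; ≤-trans; ≤-reflexive; ≤-antisym; <-≤-trans; m≤n⇒m≤1+n; <⇒≱; ≤-pred; +-suc; +-comm; +-assoc; +-identityʳ; +-monoʳ-≤; +-cancelʳ-≤; m∸n+n≡m; m≤n+o⇒m∸n≤o; m<n⇒m<1+n; ≤∧≢⇒<; module ≤-Reasoning)
open import Data.Product.Base using (∃; _×_; _,_; proj₁; proj₂)
open import Data.Sum.Base using (_⊎_; inj₁; inj₂)
open import Data.Vec.Base using (Vec; []; _∷_; take; drop; tabulate; count; here; there) renaming (_++_ to _++ᵛ_)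
open import Data.Vec.Properties using (≡-dec; lookup⇒[]=; []=⇒lookup; lookup∘tabulate)
open import Data.Vec.Relation.Unary.All using (All)
open import Data.Vec.Relation.Unary.All.Properties using (tabulate⁺)
open import Function.Base using (_∘_; id)
open import Level using (Level; 0ℓ)
open import Relation.Binary.PropositionalEquality.Core using (_≡_; _≢_; refl; sym; trans; cong; cong₂; subst)
open import Relation.Binary.PropositionalEquality.Properties using (module ≡-Reasoning)
open import Relation.Nullary using (¬_; Dec; yes; no; does; contradiction; _×-dec_; ¬?)
open import Relation.Nullary.Decidable using (dec-true; dec-false)
open import Relation.Unary using (Pred; Decidable)

private
  variable
    m n r n₁ n₂ r₁ r₂ : ℕ

exchanged : Subset n → Fin n → Fin n → Subset n
exchanged B x y = (B - x) ∪ ⁅ y ⁆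

y∈exchanged : ∀ (B : Subset n) x y → y ∈ exchanged B x y
y∈exchanged B x y = q⊆p∪q (B - x) ⁅ y ⁆ (x∈⁅x⁆ y)

∈-exchanged⁺ : ∀ {B : Subset n} {x y z} → z ∈ B → z ≢ x → z ∈ exchanged B x y
∈-exchanged⁺ {y = y} z∈B z≢x = p⊆p∪q ⁅ y ⁆ (x∈p∧x≢y⇒x∈p-y z∈B z≢x)

∈-delete⁻ : ∀ (B : Subset n) {x z} → z ∈ B - x → z ∈ B × z ≢ x
∈-delete⁻ B {x} z∈ = p─q⊆p B ⁅ x ⁆ z∈ , λ { refl → x∉p-x B _ z∈ }
  where
  x∉p-x : ∀ {k} (p : Subset k) x → ¬ (x ∈ p - x)
  x∉p-x (_ ∷ p) zero    ()
  x∉p-x (_ ∷ p) (suc x) (there x∈) = x∉p-x p x x∈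

∈-exchanged⁻ : ∀ (B : Subset n) {x y z} → z ∈ exchanged B x y → (z ∈ B × z ≢ x) ⊎ z ≡ y
∈-exchanged⁻ B {x} {y} z∈ with x∈p∪q⁻ (B - x) ⁅ y ⁆ z∈
... | inj₁ z∈B-x = inj₁ (∈-delete⁻ B z∈B-x)
... | inj₂ z∈y   = inj₂ (x∈⁅y⁆⇒x≡y y z∈y)

∈-─⁻ : ∀ (p q : Subset n) {x} → x ∈ p ─ q → x ∈ p × x ∉ q
∈-─⁻ p q x∈ = p─q⊆p p q x∈ , λ x∈q → go p q x∈ x∈q
  where
  go : ∀ {k} (p q : Subset k) {x} → x ∈ p ─ q → x ∉ q
  go (_ ∷ _) (inside ∷ _) ()         here
  go (_ ∷ p) (_ ∷ q)      (there x∈) (there x∈q) = go p q x∈ x∈q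

∣p─⊥∣ : ∀ (p : Subset n) → ∣ p ─ ⊥ ∣ ≡ ∣ p ∣
∣p─⊥∣ p = cong ∣_∣ (p─⊥≡p p)

∣delete∣ : ∀ {p : Subset n} {x} → x ∈ p → suc ∣ p - x ∣ ≡ ∣ p ∣
∣delete∣ {p = inside ∷ p}  here       = cong suc (∣p─⊥∣ p)
∣delete∣ {p = inside ∷ p}  (there x∈) = cong suc (∣delete∣ x∈)
∣delete∣ {p = outside ∷ p} (there x∈) = ∣delete∣ x∈

∣insert∣ : ∀ (p : Subset n) {x} → x ∉ p → ∣ p ∪ ⁅ x ⁆ ∣ ≡ suc ∣ p ∣
∣insert∣ (inside ∷ p)  {zero}  x∉ = contradiction here x∉
∣insert∣ (outside ∷ p) {zero}  x∉ = cong (suc ∘ ∣_∣) (∪-identityʳ p)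
∣insert∣ (inside ∷ p)  {suc x} x∉ = cong suc (∣insert∣ p (x∉ ∘ there))
∣insert∣ (outside ∷ p) {suc x} x∉ = ∣insert∣ p (x∉ ∘ there)

∣exchanged∣ : ∀ {B : Subset n} {x y} → x ∈ B → y ∉ B → ∣ exchanged B x y ∣ ≡ ∣ B ∣
∣exchanged∣ {B = B} {x} x∈B y∉B =
  trans (∣insert∣ (B - x) (y∉B ∘ proj₁ ∘ ∈-delete⁻ B)) (∣delete∣ x∈B)

∣p∣≤1+∣p-x∣ : ∀ (p : Subset n) x → ∣ p ∣ ≤ suc ∣ p - x ∣
∣p∣≤1+∣p-x∣ p x with x ∈? p
... | yes x∈p = ≤-reflexive (sym (∣delete∣ x∈p))
... | no  x∉p = m≤n⇒m≤1+n (p⊆q⇒∣p∣≤∣q∣ {p = p} {q = p - x} λ z∈p → x∈p∧x≢y⇒x∈p-y z∈p λ { refl → x∉p z∈p })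

∣q∣≡∣p∣+∣q─p∣ : ∀ {p q : Subset n} → p ⊆ q → ∣ q ∣ ≡ ∣ p ∣ + ∣ q ─ p ∣
∣q∣≡∣p∣+∣q─p∣ {p = []}          {[]}          _   = refl
∣q∣≡∣p∣+∣q─p∣ {p = inside ∷ p}  {inside ∷ q}  p⊆q = cong suc (∣q∣≡∣p∣+∣q─p∣ (drop-∷-⊆ p⊆q))
∣q∣≡∣p∣+∣q─p∣ {p = inside ∷ p}  {outside ∷ q} p⊆q with () ← p⊆q here
∣q∣≡∣p∣+∣q─p∣ {p = outside ∷ p} {inside ∷ q}  p⊆q =
  trans (cong suc (∣q∣≡∣p∣+∣q─p∣ (drop-∷-⊆ p⊆q))) (sym (+-suc ∣ p ∣ _))
∣q∣≡∣p∣+∣q─p∣ {p = outside ∷ p} {outside ∷ q} p⊆q = ∣q∣≡∣p∣+∣q─p∣ (drop-∷-⊆ p⊆q)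

⊆-or-witness : ∀ (p q : Subset n) → p ⊆ q ⊎ ∃ λ x → x ∈ p × x ∉ q
⊆-or-witness p q with any? (λ x → (x ∈? p) ×-dec ¬? (x ∈? q))
... | yes w = inj₂ w
... | no ¬w = inj₁ λ {x} x∈p → case-∈ x x∈p (x ∈? q)
  where
  case-∈ : ∀ x → x ∈ p → Dec (x ∈ q) → x ∈ q
  case-∈ x _   (yes x∈q) = x∈q
  case-∈ x x∈p (no x∉q)  = contradiction (x , x∈p , x∉q) ¬w

∈-take⁺ : ∀ {p : Subset (m + n)} {x} → x ↑ˡ n ∈ p → x ∈ take m p
∈-take⁺ {m = suc m} {p = _ ∷ _} {zero}  here       = here
∈-take⁺ {m = suc m} {p = _ ∷ _} {suc x} (there x∈) = there (∈-take⁺ x∈)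

∈-take⁻ : ∀ {p : Subset (m + n)} {x} → x ∈ take m p → x ↑ˡ n ∈ p
∈-take⁻ {m = suc m} {p = _ ∷ _} {zero}  here       = here
∈-take⁻ {m = suc m} {p = _ ∷ _} {suc x} (there x∈) = there (∈-take⁻ x∈)

∈-drop⁺ : ∀ m {p : Subset (m + n)} {x} → m ↑ʳ x ∈ p → x ∈ drop m p
∈-drop⁺ zero              x∈         = x∈
∈-drop⁺ (suc m) {_ ∷ _}   (there x∈) = ∈-drop⁺ m x∈

∈-drop⁻ : ∀ m {p : Subset (m + n)} {x} → x ∈ drop m p → m ↑ʳ x ∈ p
∈-drop⁻ zero              x∈ = x∈
∈-drop⁻ (suc m) {_ ∷ _}   x∈ = there (∈-drop⁻ m x∈)

∣take∣+∣drop∣ : ∀ m (p : Subset (m + n)) → ∣ take m p ∣ + ∣ drop m p ∣ ≡ ∣ p ∣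
∣take∣+∣drop∣ zero    p             = refl
∣take∣+∣drop∣ (suc m) (inside ∷ p)  = cong suc (∣take∣+∣drop∣ m p)
∣take∣+∣drop∣ (suc m) (outside ∷ p) = ∣take∣+∣drop∣ m p

take-++ : ∀ (p : Subset m) (q : Subset n) → take m (p ++ᵛ q) ≡ p
take-++ []      q = refl
take-++ (s ∷ p) q = cong (s ∷_) (take-++ p q)

drop-++ : ∀ (p : Subset m) (q : Subset n) → drop m (p ++ᵛ q) ≡ q
drop-++ []      q = refl
drop-++ (s ∷ p) q = drop-++ p q

↑ˡ≢↑ʳ : ∀ {x : Fin m} {y : Fin n} → x ↑ˡ n ≢ m ↑ʳ y
↑ˡ≢↑ʳ {x = suc x} eq = ↑ˡ≢↑ʳ (Fin.suc-injective eq)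

-- A matroid on the ground set Fin n, presented by its bases.  The common
-- cardinality r of the bases is the rank of the matroid.

record Matroid (n r : ℕ) : Set₁ where
  field
    Basis    : Pred (Subset n) 0ℓ
    basis?   : Decidable Basis
    nonempty : ∃ Basis
    size     : ∀ {B} → Basis B → ∣ B ∣ ≡ r
    exchange : ∀ {B C x} → Basis B → Basis C → x ∈ B → x ∉ C →
               ∃ λ y → y ∈ C × y ∉ B × Basis ((B - x) ∪ ⁅ y ⁆)

  Independent : Pred (Subset n) 0ℓ
  Independent I = ∃ λ B → Basis B × I ⊆ B

  Spanning : Pred (Subset n) 0ℓ
  Spanning S = ∃ λ B → Basis B × B ⊆ S

  independent? : Decidable Independent
  independent? I = anySubset? λ B → basis? B ×-dec (I ⊆? B)

  spanning? : Decidable Spanning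
  spanning? S = anySubset? λ B → basis? B ×-dec (B ⊆? S)

subsets : ∀ n → List (Subset n)
subsets zero    = [] ∷ []
subsets (suc n) = map (outside ∷_) (subsets n) ++ map (inside ∷_) (subsets n)

-- The largest cardinality of an independent subset of X; the default
-- value 0 of the maximum is the cardinality of the independent set ⊥.

rank : Matroid n r → Subset n → ℕ
rank {n} M X = max 0 (map ∣_∣ (filter (λ I → independent? I ×-dec (I ⊆? X)) (subsets n)))
  where open Matroid M

∈-subsets : ∀ (p : Subset n) → p ∈ˡ subsets n
∈-subsets []            = here refl
∈-subsets (outside ∷ p) = ∈-++⁺ˡ (∈-map⁺ (outside ∷_) (∈-subsets p))
∈-subsets (inside ∷ p)  = ∈-++⁺ʳ (map (outside ∷_) (subsets _)) (∈-map⁺ (inside ∷_) (∈-subsets p))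

module _ (M : Matroid n r) where
  open Matroid M

  independent-⊥ : Independent ⊥
  independent-⊥ with B , basis-B ← nonempty = B , basis-B , ⊆-min B

  independent-⊆ : ∀ {I J} → I ⊆ J → Independent J → Independent I
  independent-⊆ I⊆J (B , basis-B , J⊆B) = B , basis-B , ⊆-trans I⊆J J⊆B

  spanning-⊆ : ∀ {S T} → S ⊆ T → Spanning S → Spanning T
  spanning-⊆ S⊆T (B , basis-B , B⊆S) = B , basis-B , ⊆-trans B⊆S S⊆T

  basis-between : ∀ {I B C} → I ⊆ B → Basis B → Basis C → ∃ λ D → Basis D × I ⊆ D × D ⊆ I ∪ C
  basis-between {I} {B} {C} I⊆B basis-B basis-C = go (suc ∣ B ─ (I ∪ C) ∣) ≤-refl I⊆B basis-B
    where
    go : ∀ k {B} → ∣ B ─ (I ∪ C) ∣ < k → I ⊆ B → Basis B → ∃ λ D → Basis D × I ⊆ D × D ⊆ I ∪ C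
    go (suc k) {B} (s≤s ≤k) I⊆B basis-B with ⊆-or-witness B (I ∪ C)
    ... | inj₁ B⊆I∪C           = B , basis-B , I⊆B , B⊆I∪C
    ... | inj₂ (x , x∈B , x∉) with exchange basis-B basis-C x∈B (x∉ ∘ q⊆p∪q I C)
    ...   | y , y∈C , y∉B , basis-B′ = go k (<-≤-trans (p⊂q⇒∣p∣<∣q∣ smaller) ≤k) I⊆B′ basis-B′
      where
      I⊆B′ : I ⊆ exchanged B x y
      I⊆B′ z∈I = ∈-exchanged⁺ (I⊆B z∈I) λ { refl → x∉ (p⊆p∪q C z∈I) }

      smaller-⊆ : exchanged B x y ─ (I ∪ C) ⊆ B ─ (I ∪ C)
      smaller-⊆ z∈ with z∈B′ , z∉ ← ∈-─⁻ _ (I ∪ C) z∈ with ∈-exchanged⁻ B z∈B′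
      ... | inj₁ (z∈B , _) = x∈p∧x∉q⇒x∈p─q z∈B z∉
      ... | inj₂ refl      = contradiction (q⊆p∪q I C y∈C) z∉

      x∉smaller : x ∉ exchanged B x y ─ (I ∪ C)
      x∉smaller x∈ with ∈-exchanged⁻ B (proj₁ (∈-─⁻ _ (I ∪ C) x∈))
      ... | inj₁ (_ , x≢x) = x≢x refl
      ... | inj₂ refl      = y∉B x∈B

      smaller : exchanged B x y ─ (I ∪ C) ⊂ B ─ (I ∪ C)
      smaller = smaller-⊆ , x , x∈p∧x∉q⇒x∈p─q x∈B x∉ , x∉smaller

  augment : ∀ {I J} → Independent I → Independent J → ∣ I ∣ < ∣ J ∣ →
            ∃ λ y → y ∈ J × y ∉ I × Independent (I ∪ ⁅ y ⁆)
  augment {I} {J} (B , basis-B , I⊆B) (C , basis-C , J⊆C) ∣I∣<∣J∣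
    with D , basis-D , I⊆D , D⊆I∪C ← basis-between I⊆B basis-B basis-C
    with any? (λ y → (y ∈? D) ×-dec ((y ∈? J) ×-dec ¬? (y ∈? I)))
  ... | yes (y , y∈D , y∈J , y∉I) = y , y∈J , y∉I , D , basis-D , I∪y⊆D
    where
    I∪y⊆D : I ∪ ⁅ y ⁆ ⊆ D
    I∪y⊆D z∈ with x∈p∪q⁻ I ⁅ y ⁆ z∈
    ... | inj₁ z∈I = I⊆D z∈I
    ... | inj₂ z∈y = subst (_∈ D) (sym (x∈⁅y⁆⇒x≡y y z∈y)) y∈D
  ... | no none = contradiction ∣J∣≤∣I∣ (<⇒≱ ∣I∣<∣J∣)
    where
    D─I⊆C─J : D ─ I ⊆ C ─ J
    D─I⊆C─J {z} z∈ with z∈D , z∉I ← ∈-─⁻ D I z∈ with x∈p∪q⁻ I C (D⊆I∪C z∈D)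
    ... | inj₁ z∈I = contradiction z∈I z∉I
    ... | inj₂ z∈C = x∈p∧x∉q⇒x∈p─q z∈C λ z∈J → none (z , z∈D , z∈J , z∉I)

    open ≤-Reasoning

    ∣J∣≤∣I∣ : ∣ J ∣ ≤ ∣ I ∣
    ∣J∣≤∣I∣ = +-cancelʳ-≤ (∣ D ─ I ∣) (∣ J ∣) (∣ I ∣) (begin
      ∣ J ∣ + ∣ D ─ I ∣ ≤⟨ +-monoʳ-≤ ∣ J ∣ (p⊆q⇒∣p∣≤∣q∣ D─I⊆C─J) ⟩
      ∣ J ∣ + ∣ C ─ J ∣ ≡⟨ ∣q∣≡∣p∣+∣q─p∣ J⊆C ⟨
      ∣ C ∣             ≡⟨ trans (size basis-C) (sym (size basis-D)) ⟩
      ∣ D ∣             ≡⟨ ∣q∣≡∣p∣+∣q─p∣ I⊆D ⟩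
      ∣ I ∣ + ∣ D ─ I ∣ ∎)

  ∣independent∣≤rank : ∀ {I X} → Independent I → I ⊆ X → ∣ I ∣ ≤ rank M X
  ∣independent∣≤rank {I} {X} indep I⊆X = Allˡ.lookup (xs≤max 0 _)
    (∈-map⁺ ∣_∣ (∈-filter⁺ (λ I → independent? I ×-dec (I ⊆? X)) (∈-subsets I) (indep , λ {x} → I⊆X {x})))

  rank-attained : ∀ X → ∃ λ I → Independent I × I ⊆ X × ∣ I ∣ ≡ rank M X
  rank-attained X with argmax-sel id 0 (map ∣_∣ (filter (λ I → independent? I ×-dec (I ⊆? X)) (subsets n)))
  ... | inj₁ max≡0 = ⊥ , independent-⊥ , ⊆-min X , trans (∣⊥∣≡0 n) (sym max≡0)
  ... | inj₂ max∈
    with I , I∈ , max≡∣I∣ ← ∈-map⁻ ∣_∣ max∈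
    with _ , indep , I⊆X ← ∈-filter⁻ (λ I → independent? I ×-dec (I ⊆? X)) {xs = subsets n} I∈
    = I , indep , I⊆X , sym max≡∣I∣

  rank-mono : ∀ {X Y} → X ⊆ Y → rank M X ≤ rank M Y
  rank-mono {X} X⊆Y with I , indep , I⊆X , ∣I∣≡ ← rank-attained X =
    subst (_≤ _) ∣I∣≡ (∣independent∣≤rank indep (⊆-trans I⊆X X⊆Y))

  rank-delete : ∀ {X Y} x → Y - x ⊆ X → rank M Y ≤ suc (rank M X)
  rank-delete {X} {Y} x Y-x⊆X with I , indep , I⊆Y , ∣I∣≡ ← rank-attained Y =
    subst (_≤ _) ∣I∣≡ (≤-trans (∣p∣≤1+∣p-x∣ I x)
      (s≤s (∣independent∣≤rank (independent-⊆ (p─q⊆p I ⁅ x ⁆) indep) I-x⊆X)))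
    where
    I-x⊆X : I - x ⊆ X
    I-x⊆X z∈ with z∈I , z≢x ← ∈-delete⁻ I z∈ = Y-x⊆X (x∈p∧x≢y⇒x∈p-y (I⊆Y z∈I) z≢x)

  rank-empty : ∀ {X} → X ⊆ ⊥ → rank M X ≡ 0
  rank-empty {X} X⊆⊥ with I , _ , I⊆X , ∣I∣≡ ← rank-attained X =
    ≤-antisym (subst (_≤ 0) ∣I∣≡ (subst (∣ I ∣ ≤_) (∣⊥∣≡0 n) (p⊆q⇒∣p∣≤∣q∣ (⊆-trans I⊆X X⊆⊥)))) z≤n

  rank-full : ∀ {X} → ⊤ ⊆ X → rank M X ≡ r
  rank-full {X} ⊤⊆X with I , (B , basis-B , I⊆B) , _ , ∣I∣≡ ← rank-attained X =
    ≤-antisym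
      (subst (_≤ r) ∣I∣≡ (subst (∣ I ∣ ≤_) (size basis-B) (p⊆q⇒∣p∣≤∣q∣ I⊆B)))
      (subst (_≤ _) (size basis-B) (∣independent∣≤rank (B , basis-B , ⊆-refl) (⊆-trans (⊆-max B) ⊤⊆X)))

module _ (M₁ : Matroid n₁ r₁) (M₂ : Matroid n₂ r₂) where
  private
    module M₁ = Matroid M₁
    module M₂ = Matroid M₂

  -- Fin n₁ and Fin n₂ are made disjoint by embedding them in Fin (n₁ + n₂)
  -- as the first n₁ and the last n₂ elements, so that take n₁ B and
  -- drop n₁ B are the traces of B on the two ground sets.

  FreeProductBasis : Pred (Subset (n₁ + n₂)) 0ℓ
  FreeProductBasis B = ∣ B ∣ ≡ r₁ + r₂ × M₁.Independent (take n₁ B) × M₂.Spanning (drop n₁ B)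

  private

    Target : Subset (n₁ + n₂) → Subset (n₁ + n₂) → Fin (n₁ + n₂) → Set
    Target B C x = ∃ λ y → y ∈ C × y ∉ B × FreeProductBasis ((B - x) ∪ ⁅ y ⁆)

    take-≤ : ∀ {B C} → FreeProductBasis B → FreeProductBasis C →
             drop n₁ C ⊆ drop n₁ B → ∣ take n₁ B ∣ ≤ ∣ take n₁ C ∣
    take-≤ {B} {C} (∣B∣≡ , _) (∣C∣≡ , _) dropC⊆dropB = +-cancelʳ-≤ ∣ drop n₁ C ∣ _ _ (begin
      ∣ take n₁ B ∣ + ∣ drop n₁ C ∣ ≤⟨ +-monoʳ-≤ ∣ take n₁ B ∣ (p⊆q⇒∣p∣≤∣q∣ dropC⊆dropB) ⟩
      ∣ take n₁ B ∣ + ∣ drop n₁ B ∣ ≡⟨ ∣take∣+∣drop∣ n₁ B ⟩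
      ∣ B ∣                         ≡⟨ trans ∣B∣≡ (sym ∣C∣≡) ⟩
      ∣ C ∣                         ≡⟨ ∣take∣+∣drop∣ n₁ C ⟨
      ∣ take n₁ C ∣ + ∣ drop n₁ C ∣ ∎)
      where open ≤-Reasoning

    take-< : ∀ {B C} → FreeProductBasis B → FreeProductBasis C →
             drop n₁ C ⊂ drop n₁ B → ∣ take n₁ B ∣ < ∣ take n₁ C ∣
    take-< {B} {C} (∣B∣≡ , _) (∣C∣≡ , _) dropC⊂dropB = +-cancelʳ-≤ ∣ drop n₁ C ∣ _ _ (begin
      suc (∣ take n₁ B ∣ + ∣ drop n₁ C ∣) ≡⟨ +-suc ∣ take n₁ B ∣ _ ⟨
      ∣ take n₁ B ∣ + suc ∣ drop n₁ C ∣   ≤⟨ +-monoʳ-≤ ∣ take n₁ B ∣ (p⊂q⇒∣p∣<∣q∣ dropC⊂dropB) ⟩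
      ∣ take n₁ B ∣ + ∣ drop n₁ B ∣       ≡⟨ ∣take∣+∣drop∣ n₁ B ⟩
      ∣ B ∣                               ≡⟨ trans ∣B∣≡ (sym ∣C∣≡) ⟩
      ∣ C ∣                               ≡⟨ ∣take∣+∣drop∣ n₁ C ⟨
      ∣ take n₁ C ∣ + ∣ drop n₁ C ∣       ∎)
      where open ≤-Reasoning

    exchange-left : ∀ {B C} i → FreeProductBasis B → FreeProductBasis C →
                    i ↑ˡ n₂ ∈ B → i ↑ˡ n₂ ∉ C → Target B C (i ↑ˡ n₂)
    exchange-left {B} {C} i fB@(∣B∣≡ , indB , spanB) fC@(_ , indC , _) x∈B x∉C
      with ⊆-or-witness (drop n₁ C) (drop n₁ B)
    ... | inj₂ (y , y∈C , y∉B) =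
        n₁ ↑ʳ y , ∈-drop⁻ n₁ y∈C , y∉B ∘ ∈-drop⁺ n₁ ,
        trans (∣exchanged∣ x∈B (y∉B ∘ ∈-drop⁺ n₁)) ∣B∣≡ ,
        independent-⊆ M₁ take⊆ indB , spanning-⊆ M₂ drop⊆ spanB
      where
      take⊆ : take n₁ (exchanged B (i ↑ˡ n₂) (n₁ ↑ʳ y)) ⊆ take n₁ B
      take⊆ z∈ with ∈-exchanged⁻ B (∈-take⁻ z∈)
      ... | inj₁ (z∈B , _) = ∈-take⁺ z∈B
      ... | inj₂ z≡y       = contradiction z≡y ↑ˡ≢↑ʳ

      drop⊆ : drop n₁ B ⊆ drop n₁ (exchanged B (i ↑ˡ n₂) (n₁ ↑ʳ y))
      drop⊆ z∈ = ∈-drop⁺ n₁ (∈-exchanged⁺ (∈-drop⁻ n₁ z∈) (↑ˡ≢↑ʳ ∘ sym))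
    ... | inj₁ dropC⊆dropB
      with y , y∈C , y∉B-i , ind ← augment M₁ (independent-⊆ M₁ (p─q⊆p (take n₁ B) ⁅ i ⁆) indB) indC
             (subst (_≤ _) (sym (∣delete∣ (∈-take⁺ x∈B))) (take-≤ fB fC dropC⊆dropB))
      = y ↑ˡ n₂ , ∈-take⁻ y∈C , y∉B , trans (∣exchanged∣ x∈B y∉B) ∣B∣≡ ,
        independent-⊆ M₁ take⊆ ind , spanning-⊆ M₂ drop⊆ spanB
      where
      y∉B : y ↑ˡ n₂ ∉ B
      y∉B y∈B = y∉B-i (x∈p∧x≢y⇒x∈p-y (∈-take⁺ y∈B) λ { refl → x∉C (∈-take⁻ y∈C) })

      take⊆ : take n₁ (exchanged B (i ↑ˡ n₂) (y ↑ˡ n₂)) ⊆ (take n₁ B - i) ∪ ⁅ y ⁆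
      take⊆ {z} z∈ with ∈-exchanged⁻ B (∈-take⁻ z∈)
      ... | inj₁ (z∈B , z≢x) = ∈-exchanged⁺ (∈-take⁺ z∈B) (z≢x ∘ cong (_↑ˡ n₂))
      ... | inj₂ z≡y with refl ← ↑ˡ-injective n₂ z y z≡y = y∈exchanged (take n₁ B) i y

      drop⊆ : drop n₁ B ⊆ drop n₁ (exchanged B (i ↑ˡ n₂) (y ↑ˡ n₂))
      drop⊆ z∈ = ∈-drop⁺ n₁ (∈-exchanged⁺ (∈-drop⁻ n₁ z∈) (↑ˡ≢↑ʳ ∘ sym))

    exchange-right : ∀ {B C} i → FreeProductBasis B → FreeProductBasis C →
                     n₁ ↑ʳ i ∈ B → n₁ ↑ʳ i ∉ C → Target B C (n₁ ↑ʳ i)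
    exchange-right {B} {C} i fB@(∣B∣≡ , indB , D , basis-D , D⊆B) fC@(_ , indC , D′ , basis-D′ , D′⊆C) x∈B x∉C = result
      where
      x : Fin (n₁ + n₂)
      x = n₁ ↑ʳ i

      drop-delete⊆ : ∀ y → drop n₁ B - i ⊆ drop n₁ (exchanged B x y)
      drop-delete⊆ y {z} z∈ with z∈B , z≢i ← ∈-delete⁻ (drop n₁ B) z∈ =
        ∈-drop⁺ n₁ (∈-exchanged⁺ (∈-drop⁻ n₁ z∈B) (z≢i ∘ ↑ʳ-injective n₁ z i))

      add-right : ∀ y → y ∈ drop n₁ C → y ∉ drop n₁ B →
                  M₂.Spanning (drop n₁ (exchanged B x (n₁ ↑ʳ y))) → Target B C x
      add-right y y∈C y∉B span =
        n₁ ↑ʳ y , ∈-drop⁻ n₁ y∈C , y∉B ∘ ∈-drop⁺ n₁ ,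
        trans (∣exchanged∣ x∈B (y∉B ∘ ∈-drop⁺ n₁)) ∣B∣≡ , independent-⊆ M₁ take⊆ indB , span
        where
        take⊆ : take n₁ (exchanged B x (n₁ ↑ʳ y)) ⊆ take n₁ B
        take⊆ z∈ with ∈-exchanged⁻ B (∈-take⁻ z∈)
        ... | inj₁ (z∈B , _) = ∈-take⁺ z∈B
        ... | inj₂ z≡y       = contradiction z≡y ↑ˡ≢↑ʳ

      result : Target B C x
      result with M₂.spanning? (drop n₁ B - i)
      result | yes span with ⊆-or-witness (drop n₁ C) (drop n₁ B)
      ... | inj₂ (y , y∈C , y∉B) = add-right y y∈C y∉B (spanning-⊆ M₂ (drop-delete⊆ (n₁ ↑ʳ y)) span)
      ... | inj₁ dropC⊆dropB
        with y , y∈C , y∉B , ind ← augment M₁ indB indC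
               (take-< fB fC (dropC⊆dropB , i , ∈-drop⁺ n₁ x∈B , x∉C ∘ ∈-drop⁻ n₁))
        = y ↑ˡ n₂ , ∈-take⁻ y∈C , y∉B ∘ ∈-take⁺ ,
          trans (∣exchanged∣ x∈B (y∉B ∘ ∈-take⁺)) ∣B∣≡ ,
          independent-⊆ M₁ take⊆ ind , spanning-⊆ M₂ (drop-delete⊆ (y ↑ˡ n₂)) span
        where
        take⊆ : take n₁ (exchanged B x (y ↑ˡ n₂)) ⊆ take n₁ B ∪ ⁅ y ⁆
        take⊆ {z} z∈ with ∈-exchanged⁻ B (∈-take⁻ z∈)
        ... | inj₁ (z∈B , _) = p⊆p∪q ⁅ y ⁆ (∈-take⁺ z∈B)
        ... | inj₂ z≡y with refl ← ↑ˡ-injective n₂ z y z≡y = q⊆p∪q (take n₁ B) ⁅ y ⁆ (x∈⁅x⁆ y)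
      result | no ¬span
        with i ∈? D
      ... | no i∉D = contradiction (D , basis-D , λ {z} z∈D → x∈p∧x≢y⇒x∈p-y (D⊆B z∈D) λ { refl → i∉D z∈D }) ¬span
      ... | yes i∈D
        with y , y∈D′ , y∉D , basis-D″ ← M₂.exchange basis-D basis-D′ i∈D (x∉C ∘ ∈-drop⁻ n₁ ∘ D′⊆C)
        with y ∈? drop n₁ B
      ... | yes y∈B = contradiction (exchanged D i y , basis-D″ , λ {z} → D″⊆B-i {z}) ¬span
        where
        D″⊆B-i : exchanged D i y ⊆ drop n₁ B - i
        D″⊆B-i z∈ with ∈-exchanged⁻ D z∈
        ... | inj₁ (z∈D , z≢i) = x∈p∧x≢y⇒x∈p-y (D⊆B z∈D) z≢i
        ... | inj₂ refl        = x∈p∧x≢y⇒x∈p-y y∈B λ { refl → y∉D i∈D }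
      ... | no y∉B = add-right y (D′⊆C y∈D′) y∉B (exchanged D i y , basis-D″ , λ {z} → D″⊆ {z})
        where
        D″⊆ : exchanged D i y ⊆ drop n₁ (exchanged B x (n₁ ↑ʳ y))
        D″⊆ z∈ with ∈-exchanged⁻ D z∈
        ... | inj₁ (z∈D , z≢i) = drop-delete⊆ (n₁ ↑ʳ y) (x∈p∧x≢y⇒x∈p-y (D⊆B z∈D) z≢i)
        ... | inj₂ refl        = ∈-drop⁺ n₁ (y∈exchanged B x (n₁ ↑ʳ y))

  exchange-freeProduct : ∀ {B C x} → FreeProductBasis B → FreeProductBasis C →
                         x ∈ B → x ∉ C → Target B C x
  exchange-freeProduct {x = x} fB fC x∈B x∉C with splitAt n₁ x in eq
  ... | inj₁ i with refl ← splitAt⁻¹-↑ˡ {i = x} eq = exchange-left i fB fC x∈B x∉C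
  ... | inj₂ i with refl ← splitAt⁻¹-↑ʳ {i = x} eq = exchange-right i fB fC x∈B x∉C

  nonempty-freeProduct : ∃ FreeProductBasis
  nonempty-freeProduct with B₁ , basis-B₁ ← M₁.nonempty | B₂ , basis-B₂ ← M₂.nonempty =
    B₁ ++ᵛ B₂ ,
    trans (sym (∣take∣+∣drop∣ n₁ (B₁ ++ᵛ B₂)))
      (cong₂ _+_ (trans (cong ∣_∣ (take-++ B₁ B₂)) (M₁.size basis-B₁))
                 (trans (cong ∣_∣ (drop-++ B₁ B₂)) (M₂.size basis-B₂))) ,
    (B₁ , basis-B₁ , ⊆-reflexive (take-++ B₁ B₂)) ,
    (B₂ , basis-B₂ , ⊆-reflexive (sym (drop-++ B₁ B₂)))

infixr 7 _□_

_□_ : Matroid n₁ r₁ → Matroid n₂ r₂ → Matroid (n₁ + n₂) (r₁ + r₂)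
_□_ {n₁} {r₁} {n₂} {r₂} M₁ M₂ = record
  { Basis    = FreeProductBasis M₁ M₂
  ; basis?   = λ B → (∣ B ∣ ≟ r₁ + r₂) ×-dec independent? M₁ (take n₁ B) ×-dec spanning? M₂ (drop n₁ B)
  ; nonempty = nonempty-freeProduct M₁ M₂
  ; size     = proj₁
  ; exchange = exchange-freeProduct M₁ M₂
  }
  where open Matroid

-- A sequence is determined by its word: the two proofs are irrelevant.

record Sequence (n r : ℕ) : Set where
  field
    word  : Vec ℕ n
    .bits : All (_≤ 1) word
    .ones : count (_≟ 1) word ≡ r

-- An element e is among π(1), …, π(j) iff its position π⁻¹(e), counted
-- from 0, is less than j.

prefix : Permutation′ n → ℕ → Subset n
prefix π j = tabulate λ e → does (toℕ (π ⟨$⟩ˡ e) <? j)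

-- The rank is 0 on the empty prefix and monotone, so neither the first
-- entry nor the truncated subtraction needs special treatment.

rankWord : Matroid n r → Permutation′ n → Vec ℕ n
rankWord M π = tabulate λ i → rank M (prefix π (suc (toℕ i))) ∸ rank M (prefix π (toℕ i))

∈-prefix⁺ : ∀ (π : Permutation′ n) {j e} → toℕ (π ⟨$⟩ˡ e) < j → e ∈ prefix π j
∈-prefix⁺ π {j} {e} lt =
  lookup⇒[]= e _ (trans (lookup∘tabulate _ e) (dec-true (toℕ (π ⟨$⟩ˡ e) <? j) lt))

∈-prefix⁻ : ∀ (π : Permutation′ n) {j e} → e ∈ prefix π j → toℕ (π ⟨$⟩ˡ e) < j
∈-prefix⁻ π {j} {e} e∈ with toℕ (π ⟨$⟩ˡ e) <? j
... | yes lt = lt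
... | no ¬lt with () ← trans (sym ([]=⇒lookup e∈)) (trans (lookup∘tabulate _ e) (dec-false (toℕ (π ⟨$⟩ˡ e) <? j) ¬lt))

count-bit : ∀ d (v : Vec ℕ n) → d ≤ 1 → count (_≟ 1) (d ∷ v) ≡ d + count (_≟ 1) v
count-bit zero          v _ = refl
count-bit (suc zero)    v _ = refl
count-bit (suc (suc _)) v (s≤s ())

UnitStep : (ℕ → ℕ) → ℕ → Set
UnitStep f i = f i ≤ f (suc i) × f (suc i) ≤ suc (f i)

step-bit : ∀ f {i} → UnitStep f i → f (suc i) ∸ f i ≤ 1
step-bit f (_ , up) = m≤n+o⇒m∸n≤o _ _ (≤-trans up (≤-reflexive (+-comm 1 _)))

count-steps : ∀ n (f : ℕ → ℕ) → (∀ (i : Fin n) → UnitStep f (toℕ i)) →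
              count (_≟ 1) (tabulate {n = n} λ i → f (suc (toℕ i)) ∸ f (toℕ i)) + f 0 ≡ f n
count-steps zero    f step = refl
count-steps (suc n) f step = begin
  count (_≟ 1) (d ∷ v) + f 0   ≡⟨ cong (_+ f 0) (count-bit d v (step-bit f (step 0F))) ⟩
  d + c + f 0                  ≡⟨ cong (_+ f 0) (+-comm d c) ⟩
  c + d + f 0                  ≡⟨ +-assoc c d (f 0) ⟩
  c + (d + f 0)                ≡⟨ cong (c +_) (m∸n+n≡m (proj₁ (step 0F))) ⟩
  c + f 1                      ≡⟨ count-steps n (f ∘ suc) (step ∘ suc) ⟩
  f (suc n)                    ∎
  where
  open ≡-Reasoning
  d = f 1 ∸ f 0
  v = tabulate {n = n} λ i → f (suc (suc (toℕ i))) ∸ f (suc (toℕ i))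
  c = count (_≟ 1) v

rank-steps : ∀ (M : Matroid n r) π (i : Fin n) → UnitStep (rank M ∘ prefix π) (toℕ i)
rank-steps M π i =
  rank-mono M (λ e∈ → ∈-prefix⁺ π (m<n⇒m<1+n (∈-prefix⁻ π e∈))) ,
  rank-delete M (π ⟨$⟩ʳ i) below
  where
  below : prefix π (suc (toℕ i)) - (π ⟨$⟩ʳ i) ⊆ prefix π (toℕ i)
  below e∈ with e∈π , e≢πi ← ∈-delete⁻ (prefix π (suc (toℕ i))) e∈ =
    ∈-prefix⁺ π (≤∧≢⇒< (≤-pred (∈-prefix⁻ π e∈π)) λ eq →
      e≢πi (trans (sym (inverseʳ π)) (cong (π ⟨$⟩ʳ_) (toℕ-injective eq))))

rank-prefix-zero : ∀ (M : Matroid n r) π → rank M (prefix π 0) ≡ 0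
rank-prefix-zero M π = rank-empty M λ {e} e∈ → contradiction (∈-prefix⁻ π {0} {e} e∈) λ ()

rank-prefix-full : ∀ (M : Matroid n r) π → rank M (prefix π n) ≡ r
rank-prefix-full M π = rank-full M λ _ → ∈-prefix⁺ π (toℕ<n _)

rankSequence : Matroid n r → Permutation′ n → Sequence n r
rankSequence {n} M π = record
  { word = rankWord M π
  ; bits = tabulate⁺ λ i → step-bit (rank M ∘ prefix π) (rank-steps M π i)
  ; ones = trans (trans (sym (+-identityʳ _)) (cong (count (_≟ 1) (rankWord M π) +_) (sym (rank-prefix-zero M π))))
                 (trans (count-steps n (rank M ∘ prefix π) (rank-steps M π)) (rank-prefix-full M π))
  }

permutations : ∀ n → List (Permutation′ n)
permutations zero    = Perm.id ∷ []
permutations (suc n) = cartesianProductWith (insert 0F) (allFin (suc n)) (permutations n)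

-- Every permutation is listed, and the list has n ! entries; so each
-- permutation is listed exactly once.

permutations-complete : ∀ (π : Permutation′ n) → ∃ λ ρ → ρ ∈ˡ permutations n × ρ Perm.≈ π
permutations-complete {zero}  π = Perm.id , here refl , λ ()
permutations-complete {suc n} π with ρ , ρ∈ , ρ≈ ← permutations-complete (remove 0F π) =
  insert 0F (π ⟨$⟩ʳ 0F) ρ , ∈-cartesianProductWith⁺ (insert 0F) (∈-allFin (π ⟨$⟩ʳ 0F)) ρ∈ , insert≈
  where
  insert≈ : insert 0F (π ⟨$⟩ʳ 0F) ρ Perm.≈ π
  insert≈ zero    = refl
  insert≈ (suc k) = trans (cong (punchIn (π ⟨$⟩ʳ 0F)) (ρ≈ k)) (Perm.insert-remove 0F π (suc k))

length-permutations : ∀ n → length (permutations n) ≡ n !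
length-permutations zero    = refl
length-permutations (suc n) = trans (go (allFin (suc n)))
  (cong₂ _*_ (List.length-tabulate {n = suc n} id) (length-permutations n))
  where
  go : ∀ is → length (cartesianProductWith (insert 0F) is (permutations n)) ≡ length is * length (permutations n)
  go []       = refl
  go (i ∷ is) = trans (List.length-++ (map (insert 0F i) (permutations n)))
                      (cong₂ _+_ (List.length-map (insert 0F i) (permutations n)) (go is))

-- Every field in the classical sense is a HeytingField, with _≉_ as its
-- apartness relation.

module _ {c ℓ₁ ℓ₂ : Level} (K : HeytingField c ℓ₁ ℓ₂) where
  open HeytingField K using (_≈_; 0#; 1#; heytingCommutativeRing)

  scalars : CommutativeRing c ℓ₁
  scalars = HeytingCommutativeRing.commutativeRing heytingCommutativeRing

  open CommutativeRing scalars using (+-rawMonoid; +-isCommutativeMonoid)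
  private module K = CommutativeRing scalars
  open RawMonoidDefinitions +-rawMonoid using () renaming (_×_ to _·_)

  CharacteristicZero : Set ℓ₁
  CharacteristicZero = ∀ k → .{{NonZero k}} → ¬ (k · 1# ≈ 0#)

  -- There are finitely many (n,r)-sequences, so a formal linear
  -- combination of them is an arbitrary family of coefficients.

  𝒢-space : ℕ → ℕ → Module scalars c ℓ₁
  𝒢-space n r = record
    { Carrierᴹ = Sequence n r → K.Carrier
    ; _≈ᴹ_     = λ u v → ∀ s → u s ≈ v s
    ; _+ᴹ_     = λ u v s → u s K.+ v s
    ; _*ₗ_     = λ a u s → a K.* u s
    ; _*ᵣ_     = λ u a s → u s K.* a
    ; 0ᴹ       = λ s → 0#
    ; -ᴹ_      = λ u s → K.- u s
    ; isModule = record
      { isBimodule = record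
        { isBisemimodule = record
          { +ᴹ-isCommutativeMonoid = Pointwise.isCommutativeMonoid (Sequence n r) +-isCommutativeMonoid
          ; isPreleftSemimodule = record
            { *ₗ-cong      = λ a≈b u≈v s → K.*-cong a≈b (u≈v s)
            ; *ₗ-zeroˡ     = λ u s → K.zeroˡ (u s)
            ; *ₗ-distribʳ  = λ u a b s → K.distribʳ (u s) a b
            ; *ₗ-identityˡ = λ u s → K.*-identityˡ (u s)
            ; *ₗ-assoc     = λ a b u s → K.*-assoc a b (u s)
            ; *ₗ-zeroʳ     = λ a s → K.zeroʳ a
            ; *ₗ-distribˡ  = λ a u v s → K.distribˡ a (u s) (v s)
            }
          ; isPrerightSemimodule = record
            { *ᵣ-cong      = λ u≈v a≈b s → K.*-cong (u≈v s) a≈b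
            ; *ᵣ-zeroʳ     = λ u s → K.zeroʳ (u s)
            ; *ᵣ-distribˡ  = λ u a b s → K.distribˡ (u s) a b
            ; *ᵣ-identityʳ = λ u s → K.*-identityʳ (u s)
            ; *ᵣ-assoc     = λ u a b s → K.*-assoc (u s) a b
            ; *ᵣ-zeroˡ     = λ a s → K.zeroˡ a
            ; *ᵣ-distribʳ  = λ a u v s → K.distribʳ a (u s) (v s)
            }
          ; *ₗ-*ᵣ-assoc = λ a u b s → K.*-assoc a (u s) b
          }
        ; -ᴹ‿cong    = λ u≈v s → K.-‿cong (u≈v s)
        ; -ᴹ‿inverse = (λ u s → K.-‿inverseˡ (u s)) , (λ u s → K.-‿inverseʳ (u s))
        }
      ; *ₗ-*ᵣ-coincident = λ a u s → K.*-comm a (u s)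
      }
    }

  module _ {n r : ℕ} where
    open Module (𝒢-space n r) using (Carrierᴹ; _+ᴹ_; 0ᴹ)

    symbol : Sequence n r → Carrierᴹ
    symbol s t = if does (≡-dec _≟_ (Sequence.word s) (Sequence.word t)) then 1# else 0#

    𝒢 : Matroid n r → Carrierᴹ
    𝒢 M = foldr _+ᴹ_ 0ᴹ (map (λ π → symbol (rankSequence M π)) (permutations n))

module Submission where

-- By the rank formula, the rank word of M₁ □ M₂ along an ordering of the
-- disjoint union depends only on the rank words of M₁ and M₂ along the two
-- induced orderings and on how these are interleaved.  Every ordering of the
-- union is, in exactly one way, a shuffle of an ordering of E₁ with one of E₂,
-- so the multiset of rank words of M₁ □ M₂ is a function of those of M₁ and
-- M₂.  In characteristic zero, 𝒢 determines the multiset of rank words.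

open import Defs
open import Algebra.Apartness.Bundles using (HeytingField)
open import Algebra.Bundles using (module CommutativeRing)
open import Algebra.Module.Bundles using (module Module)
import Algebra.Properties.Monoid.Mult as MonoidMult
import Algebra.Properties.Ring as RingProperties
open import Data.Bool.Base using (true; false)
open import Data.Fin.Base using (Fin; zero; suc; toℕ; punchIn; _↑ˡ_; _↑ʳ_)
open import Data.Fin.Patterns using (0F)
open import Data.Fin.Permutation using (Permutation′; _⟨$⟩ʳ_; _⟨$⟩ˡ_; insert; inverseˡ; inverseʳ)
open import Data.Fin.Properties using (toℕ-injective)
open import Data.Fin.Subset using (Subset; inside; outside; _∈_; _∉_; _⊆_; _∪_; _∩_; _─_; ⁅_⁆; ∣_∣; ⊥)
open import Data.Fin.Subset.Properties
open import Data.List.Base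
  using (List; []; _∷_; _++_; map; concatMap; tabulate; allFin; filter; length; foldr; cartesianProductWith)
open import Data.List.Membership.Propositional using () renaming (_∈_ to _∈ˡ_)
open import Data.List.Membership.Propositional.Properties using (∈-map⁻; ∈-∃++)
open import Data.List.Properties
  using (++-identityʳ; ++-assoc; map-id; map-∘; map-cong; map-++; map-tabulate; map-concatMap; concatMap-map;
         concatMap-++; concatMap-pure; concatMap-cong; length-map; length-tabulate)
  renaming (≡-dec to ≡-decˡ)
open import Data.List.Relation.Binary.Permutation.Propositional as ↭
  using (_↭_; prep; swap; ↭-sym; ↭-trans; ↭-reflexive; module PermutationReasoning)
open import Data.List.Relation.Binary.Permutation.Propositional.Properties
  using (++⁺; ++⁺ˡ; map⁺; shift; shifts; filter-↭; ↭-length; ∈-resp-↭)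
open import Data.List.Relation.Unary.All as All using (All; []; _∷_)
import Data.List.Relation.Unary.All.Properties as All
open import Data.List.Relation.Unary.AllPairs using (_∷_)
open import Data.List.Relation.Unary.Any using (here; there)
open import Data.List.Relation.Unary.Unique.Propositional using (Unique)
import Data.List.Relation.Unary.Unique.Propositional.Properties as Unique
open import Data.Nat.Base using (ℕ; zero; suc; _+_; _∸_; _⊓_; _≤_; _<_; z≤n; s≤s)
open import Data.Nat.Properties
open import Data.Product.Base using (_×_; _,_; map₂; proj₂; ∃)
open import Data.Sum.Base using (_⊎_; inj₁; inj₂; [_,_]′)
open import Data.Vec.Base as Vec using ([]; _∷_; take; drop; here; there; toList) renaming (_++_ to _++ᵛ_)
open import Data.Vec.Properties using (≡-dec; toList-injective; cast-is-id)
open import Function.Base using (_∘_; id)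
open import Function.Bundles using (mk⇔)
open import Level using (Level)
open import Relation.Binary.Definitions using (DecidableEquality; tri<; tri≈; tri>)
open import Relation.Binary.PropositionalEquality using (_≡_; refl; sym; trans; cong; cong₂; subst; module ≡-Reasoning)
open import Relation.Nullary using (¬_; yes; no; does; contradiction)
open import Relation.Nullary.Decidable using (does-⇔)

-- Orderings are kept as lists of elements and multisets as lists up to `↭`, so that decomposing an
-- ordering of the union becomes an induction on its first element. Once that element is removed,
-- the rest is no longer of the form `allFin k`; hence `arrangements` takes an arbitrary list.
-- Interleaved words suffice because every ingredient of the rank formula min(r₁ + r₂(X₂), r₁(X₁) +
-- |X₂|) can be read off from initial segments of the two words: the ranks are partial sums, and
-- |X₂| is the number of letters already taken from the second word. The formula itself has to be
-- proved, since `_□_` is defined by its bases.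

private
  variable
    a b c d : Level
    A : Set a
    B : Set b
    C : Set c
    D : Set d
    m n r n₁ n₂ r₁ r₂ : ℕ

-- Sums of multisets, represented by lists up to permutation

concatMap-concatMap : ∀ (f : B → List C) (g : A → List B) xs →
                      concatMap f (concatMap g xs) ≡ concatMap (concatMap f ∘ g) xs
concatMap-concatMap f g []       = refl
concatMap-concatMap f g (x ∷ xs) =
  trans (concatMap-++ f (g x) (concatMap g xs)) (cong (concatMap f (g x) ++_) (concatMap-concatMap f g xs))

concatMap⁺ : ∀ (f : A → List B) {xs ys} → xs ↭ ys → concatMap f xs ↭ concatMap f ys
concatMap⁺ f ↭.refl                   = ↭.refl
concatMap⁺ f (prep x xs↭ys)         = ++⁺ˡ (f x) (concatMap⁺ f xs↭ys)
concatMap⁺ f (swap x y xs↭ys)       = ↭-trans (shifts (f x) (f y)) (++⁺ˡ (f y) (++⁺ˡ (f x) (concatMap⁺ f xs↭ys)))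
concatMap⁺ f (↭.trans xs↭ys ys↭zs)    = ↭-trans (concatMap⁺ f xs↭ys) (concatMap⁺ f ys↭zs)

-- The comparison is demanded only on entries of `xs` because it will depend on a property of them:
-- the length of a remainder in `arrangements-++`, the absence of repetitions in `rankWords-□`.
concatMap-cong-All : ∀ {f g : A → List B} {xs} → All (λ x → f x ↭ g x) xs → concatMap f xs ↭ concatMap g xs
concatMap-cong-All []       = ↭.refl
concatMap-cong-All (p ∷ ps) = ++⁺ p (concatMap-cong-All ps)

concatMap-cong-↭ : ∀ {f g : A → List B} → (∀ x → f x ↭ g x) → ∀ xs → concatMap f xs ↭ concatMap g xs
concatMap-cong-↭ f↭g xs = concatMap-cong-All (All.universal f↭g xs)

concatMap-[] : ∀ (xs : List A) → concatMap {B = B} (λ _ → []) xs ≡ []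
concatMap-[] []       = refl
concatMap-[] (x ∷ xs) = concatMap-[] xs

concatMap-distrib-++ : ∀ (f g : A → List B) xs →
                       concatMap (λ x → f x ++ g x) xs ↭ concatMap f xs ++ concatMap g xs
concatMap-distrib-++ f g []       = ↭.refl
concatMap-distrib-++ f g (x ∷ xs) = begin
  (f x ++ g x) ++ concatMap (λ x → f x ++ g x) xs ↭⟨ ++⁺ˡ (f x ++ g x) (concatMap-distrib-++ f g xs) ⟩
  (f x ++ g x) ++ F ++ G                          ≡⟨ ++-assoc (f x) (g x) (F ++ G) ⟩
  f x ++ g x ++ F ++ G                            ↭⟨ ++⁺ˡ (f x) (shifts (g x) F) ⟩
  f x ++ F ++ g x ++ G                            ≡⟨ ++-assoc (f x) F (g x ++ G) ⟨
  (f x ++ F) ++ g x ++ G                          ∎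
  where
  open PermutationReasoning
  F = concatMap f xs
  G = concatMap g xs

-- Interchange of two finite sums, for unions of multisets.
concatMap-comm : ∀ (f : A → B → List C) xs ys →
                 concatMap (λ x → concatMap (f x) ys) xs ↭ concatMap (λ y → concatMap (λ x → f x y) xs) ys
concatMap-comm f []       ys = ↭-reflexive (sym (concatMap-[] ys))
concatMap-comm f (x ∷ xs) ys = ↭-trans (++⁺ˡ (concatMap (f x) ys) (concatMap-comm f xs ys))
  (↭-sym (concatMap-distrib-++ (f x) (λ y → concatMap (λ x → f x y) xs) ys))

-- Shuffles and arrangements of lists

shuffles : List A → List A → List (List A)
shuffles []       []       = [] ∷ []
-- With one list exhausted, elements are still taken one at a time, so that every nonempty case of
-- `rankSteps-shuffles` is assembled from `consˡ` and `consʳ`.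
shuffles []       (v ∷ vs) = map (v ∷_) (shuffles [] vs)
shuffles (u ∷ us) []       = map (u ∷_) (shuffles us [])
shuffles (u ∷ us) (v ∷ vs) = map (u ∷_) (shuffles us (v ∷ vs)) ++ map (v ∷_) (shuffles (u ∷ us) vs)

shuffles-[]ˡ : ∀ (vs : List A) → shuffles [] vs ≡ vs ∷ []
shuffles-[]ˡ []       = refl
shuffles-[]ˡ (v ∷ vs) = cong (map (v ∷_)) (shuffles-[]ˡ vs)

shuffles-[]ʳ : ∀ (us : List A) → shuffles us [] ≡ us ∷ []
shuffles-[]ʳ []       = refl
shuffles-[]ʳ (u ∷ us) = cong (map (u ∷_)) (shuffles-[]ʳ us)

selections : List A → List (A × List A)
selections []       = []
selections (x ∷ xs) = (x , xs) ∷ map (map₂ (x ∷_)) (selections xs)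

selections-length : ∀ (xs : List A) → All (λ s → suc (length (proj₂ s)) ≡ length xs) (selections xs)
selections-length []       = []
selections-length (x ∷ xs) = refl ∷ All.map⁺ (All.map (cong suc) (selections-length xs))

selections-++ : ∀ (xs ys : List A) → selections (xs ++ ys) ≡
                map (map₂ (_++ ys)) (selections xs) ++ map (map₂ (xs ++_)) (selections ys)
selections-++ []       ys = sym (trans (map-cong (λ _ → refl) (selections ys)) (map-id _))
selections-++ (x ∷ xs) ys = cong ((x , xs ++ ys) ∷_) (begin
  map (map₂ (x ∷_)) (selections (xs ++ ys))
    ≡⟨ cong (map (map₂ (x ∷_))) (selections-++ xs ys) ⟩
  map (map₂ (x ∷_)) (map (map₂ (_++ ys)) (selections xs) ++ map (map₂ (xs ++_)) (selections ys))
    ≡⟨ map-++ _ (map (map₂ (_++ ys)) (selections xs)) _ ⟩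
  map (map₂ (x ∷_)) (map (map₂ (_++ ys)) (selections xs)) ++ map (map₂ (x ∷_)) (map (map₂ (xs ++_)) (selections ys))
    ≡⟨ cong₂ _++_ (trans (sym (map-∘ (selections xs))) (map-∘ (selections xs))) (sym (map-∘ (selections ys))) ⟩
  map (map₂ (_++ ys)) (map (map₂ (x ∷_)) (selections xs)) ++ map (map₂ ((x ∷ xs) ++_)) (selections ys) ∎)
  where
  open ≡-Reasoning

selections-map : ∀ (f : A → B) xs → selections (map f xs) ≡ map (λ (x , xs′) → f x , map f xs′) (selections xs)
selections-map f []       = refl
selections-map f (x ∷ xs) = cong ((f x , map f xs) ∷_) (trans
  (cong (map (map₂ (f x ∷_))) (selections-map f xs))
  (trans (sym (map-∘ (selections xs))) (map-∘ (selections xs))))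

-- All orderings of `xs` when `k` is its length. The recursion is on `k` because a remainder
-- produced by `selections` is not a structural part of `xs`.
arrangements : ℕ → List A → List (List A)
arrangements zero    xs = [] ∷ []
arrangements (suc k) xs = concatMap (λ (x , xs′) → map (x ∷_) (arrangements k xs′)) (selections xs)

concatMap-arrangements : ∀ (f : List A → List B) k xs → concatMap f (arrangements (suc k) xs) ≡
                         concatMap (λ (x , xs′) → concatMap (f ∘ (x ∷_)) (arrangements k xs′)) (selections xs)
concatMap-arrangements f k xs = trans
  (concatMap-concatMap f (λ (x , xs′) → map (x ∷_) (arrangements k xs′)) (selections xs))
  (concatMap-cong (λ (x , xs′) → concatMap-map f (x ∷_) (arrangements k xs′)) (selections xs))

arrangements-map : ∀ (f : A → B) k xs → arrangements k (map f xs) ≡ map (map f) (arrangements k xs)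
arrangements-map f zero    xs = refl
arrangements-map f (suc k) xs = begin
  concatMap (λ (y , ys) → map (y ∷_) (arrangements k ys)) (selections (map f xs))
    ≡⟨ cong (concatMap _) (selections-map f xs) ⟩
  concatMap (λ (y , ys) → map (y ∷_) (arrangements k ys)) (map (λ (x , xs′) → f x , map f xs′) (selections xs))
    ≡⟨ concatMap-map _ _ (selections xs) ⟩
  concatMap (λ (x , xs′) → map (f x ∷_) (arrangements k (map f xs′))) (selections xs)
    ≡⟨ concatMap-cong (λ (x , xs′) → step x xs′) (selections xs) ⟩
  concatMap (λ (x , xs′) → map (map f) (map (x ∷_) (arrangements k xs′))) (selections xs)
    ≡⟨ map-concatMap (map f) _ (selections xs) ⟨
  map (map f) (arrangements (suc k) xs) ∎
  where
  open ≡-Reasoning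
  step : ∀ x xs′ → map (f x ∷_) (arrangements k (map f xs′)) ≡ map (map f) (map (x ∷_) (arrangements k xs′))
  step x xs′ = trans (cong (map (f x ∷_)) (arrangements-map f k xs′))
    (trans (sym (map-∘ (arrangements k xs′))) (map-∘ (arrangements k xs′)))

infix 6 _⧢_

_⧢_ : List (List A) → List (List A) → List (List A)
uss ⧢ vss = concatMap (λ us → concatMap (shuffles us) vss) uss

-- Both sides are split by their first element. In an arrangement of `xs ++ ys` it is selected from
-- `xs` or from `ys`, and the induction hypothesis applies to what remains; in a shuffle of `us`
-- with `vs` it is the head of `us` or the head of `vs`.
arrangements-++ : ∀ m n (xs ys : List A) → length xs ≡ m → length ys ≡ n →
                  arrangements (m + n) (xs ++ ys) ↭ arrangements m xs ⧢ arrangements n ys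
arrangements-++ zero n [] ys _ _ = ↭-reflexive (sym (trans
  (++-identityʳ _)
  (trans (concatMap-cong shuffles-[]ˡ (arrangements n ys)) (concatMap-pure (arrangements n ys)))))
arrangements-++ m@(suc _) zero xs [] _ _ = ↭-reflexive (trans
  (cong₂ arrangements (+-identityʳ m) (++-identityʳ xs))
  (sym (trans
    (concatMap-cong (λ us → trans (++-identityʳ _) (shuffles-[]ʳ us)) (arrangements m xs))
    (concatMap-pure (arrangements m xs)))))
arrangements-++ {A = A} (suc m) (suc n) xs ys ∣xs∣ ∣ys∣ = begin
  arrangements (suc m + suc n) (xs ++ ys)
    ≡⟨ trans (cong (concatMap choose) (selections-++ xs ys))
         (trans (concatMap-++ choose (map (map₂ (_++ ys)) (selections xs)) _)
           (cong₂ _++_ (concatMap-map choose _ (selections xs)) (concatMap-map choose _ (selections ys)))) ⟩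
  concatMap (λ (x , xs′) → map (x ∷_) (arrangements (m + suc n) (xs′ ++ ys))) (selections xs) ++
  concatMap (λ (y , ys′) → map (y ∷_) (arrangements (m + suc n) (xs ++ ys′))) (selections ys)
    -- In the second summand the choice of the first element `y` is outermost; the interchange moves
    -- the arrangement of `xs` outside, where `_⧢_` has it.
    ↭⟨ ++⁺ (concatMap-cong-All (All.map (λ {s} → left s) (selections-length xs)))
           (↭-trans (concatMap-cong-All (All.map (λ {s} → right s) (selections-length ys)))
             (concatMap-comm rightFrom (selections ys) (arrangements (suc m) xs))) ⟩
  concatMap (λ (x , xs′) → concatMap (leftFirst ∘ (x ∷_)) (arrangements m xs′)) (selections xs) ++
  concatMap (λ us → concatMap (λ s → rightFrom s us) (selections ys)) (arrangements (suc m) xs)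
    ≡⟨ cong₂ _++_ (sym (concatMap-arrangements leftFirst m xs))
         (concatMap-cong (λ us → sym (concatMap-arrangements (rightFirst us) n ys)) (arrangements (suc m) xs)) ⟩
  concatMap leftFirst (arrangements (suc m) xs) ++
  concatMap (λ us → concatMap (rightFirst us) (arrangements (suc n) ys)) (arrangements (suc m) xs)
    ↭⟨ concatMap-distrib-++ leftFirst (λ us → concatMap (rightFirst us) (arrangements (suc n) ys)) (arrangements (suc m) xs) ⟨
  concatMap (λ us → leftFirst us ++ concatMap (rightFirst us) (arrangements (suc n) ys)) (arrangements (suc m) xs)
    ≡⟨ concatMap-arrangements _ m xs ⟩
  concatMap (λ (x , xs′) → concatMap
    (λ us′ → leftFirst (x ∷ us′) ++ concatMap (rightFirst (x ∷ us′)) (arrangements (suc n) ys))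
    (arrangements m xs′)) (selections xs)
    ↭⟨ concatMap-cong-↭ (λ (x , xs′) → concatMap-cong-↭ (merge x) (arrangements m xs′)) (selections xs) ⟩
  concatMap (λ (x , xs′) → concatMap
    (λ us′ → concatMap (shuffles (x ∷ us′)) (arrangements (suc n) ys))
    (arrangements m xs′)) (selections xs)
    ≡⟨ concatMap-arrangements _ m xs ⟨
  arrangements (suc m) xs ⧢ arrangements (suc n) ys ∎
  where
  open PermutationReasoning

  choose : A × List A → List (List A)
  choose (z , zs) = map (z ∷_) (arrangements (m + suc n) zs)

  -- In `leftFirst` and `rightFirst` the value at the empty list is a default that is never reached:
  -- the arguments are arrangements of positive length.
  leftFirst : List A → List (List A)
  leftFirst []       = []
  leftFirst (u ∷ us) = concatMap (λ vs → map (u ∷_) (shuffles us vs)) (arrangements (suc n) ys)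

  rightFirst : List A → List A → List (List A)
  rightFirst us []       = []
  rightFirst us (v ∷ vs) = map (v ∷_) (shuffles us vs)

  rightFrom : A × List A → List A → List (List A)
  rightFrom (y , ys′) us = concatMap (λ vs′ → map (y ∷_) (shuffles us vs′)) (arrangements n ys′)

  left : ∀ ((x , xs′) : A × List A) → suc (length xs′) ≡ length xs →
         map (x ∷_) (arrangements (m + suc n) (xs′ ++ ys)) ↭ concatMap (leftFirst ∘ (x ∷_)) (arrangements m xs′)
  left (x , xs′) ∣xs′∣ = ↭-trans
    (map⁺ (x ∷_) (arrangements-++ m (suc n) xs′ ys (suc-injective (trans ∣xs′∣ ∣xs∣)) ∣ys∣))
    (↭-reflexive (trans (map-concatMap (x ∷_) _ (arrangements m xs′))
      (concatMap-cong (λ us′ → map-concatMap (x ∷_) (shuffles us′) (arrangements (suc n) ys)) (arrangements m xs′))))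

  right : ∀ ((y , ys′) : A × List A) → suc (length ys′) ≡ length ys →
          map (y ∷_) (arrangements (m + suc n) (xs ++ ys′)) ↭
          concatMap (rightFrom (y , ys′)) (arrangements (suc m) xs)
  right (y , ys′) ∣ys′∣ rewrite +-suc m n = ↭-trans
    (map⁺ (y ∷_) (arrangements-++ (suc m) n xs ys′ ∣xs∣ (suc-injective (trans ∣ys′∣ ∣ys∣))))
    (↭-reflexive (trans (map-concatMap (y ∷_) _ (arrangements (suc m) xs))
      (concatMap-cong (λ us → map-concatMap (y ∷_) (shuffles us) (arrangements n ys′)) (arrangements (suc m) xs))))

  merge : ∀ x us′ → leftFirst (x ∷ us′) ++ concatMap (rightFirst (x ∷ us′)) (arrangements (suc n) ys) ↭
                    concatMap (shuffles (x ∷ us′)) (arrangements (suc n) ys)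
  merge x us′ = ↭-trans
    (↭-sym (concatMap-distrib-++ (λ vs → map (x ∷_) (shuffles us′ vs)) (rightFirst (x ∷ us′)) (arrangements (suc n) ys)))
    (↭-reflexive (trans (concatMap-arrangements _ n ys) (sym (concatMap-arrangements _ n ys))))

-- Permutations as arrangements

selections-tabulate : ∀ (f : Fin (suc n) → A) →
                      selections (tabulate f) ≡ tabulate λ i → f i , tabulate (f ∘ punchIn i)
selections-tabulate {n = zero}  f = refl
selections-tabulate {n = suc n} f = cong ((f 0F , tabulate (f ∘ suc)) ∷_) (trans
  (cong (map (map₂ (f 0F ∷_))) (selections-tabulate (f ∘ suc)))
  (map-tabulate (λ i → f (suc i) , tabulate (f ∘ suc ∘ punchIn i)) (map₂ (f 0F ∷_))))

cartesianProductWith≡concatMap : ∀ (f : A → B → C) xs ys →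
                                 cartesianProductWith f xs ys ≡ concatMap (λ x → map (f x) ys) xs
cartesianProductWith≡concatMap f []       ys = refl
cartesianProductWith≡concatMap f (x ∷ xs) ys = cong (map (f x) ys ++_) (cartesianProductWith≡concatMap f xs ys)

-- `insert 0F i ρ` lists `i` first and then the values of `ρ` relabelled by `punchIn i`. The family
-- `f` absorbs the relabelling, so the induction hypothesis is used at `f ∘ punchIn i`. Both
-- recursions choose the first value in increasing order, which gives equal lists.
permutations-arrangements : ∀ n (f : Fin n → A) →
  map (λ π → tabulate (f ∘ (π ⟨$⟩ʳ_))) (permutations n) ≡ arrangements n (tabulate f)
permutations-arrangements zero    f = refl
permutations-arrangements (suc n) f = begin
  map image (permutations (suc n))
    ≡⟨ cong (map image) (cartesianProductWith≡concatMap (insert 0F) (allFin (suc n)) (permutations n)) ⟩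
  map image (concatMap (λ i → map (insert 0F i) (permutations n)) (allFin (suc n)))
    ≡⟨ map-concatMap image _ (allFin (suc n)) ⟩
  concatMap (λ i → map image (map (insert 0F i) (permutations n))) (allFin (suc n))
    ≡⟨ concatMap-cong starting-with (allFin (suc n)) ⟩
  concatMap (λ i → map (f i ∷_) (arrangements n (tabulate (f ∘ punchIn i)))) (allFin (suc n))
    ≡⟨ concatMap-map _ _ (allFin (suc n)) ⟨
  concatMap (λ (x , xs) → map (x ∷_) (arrangements n xs)) (map (λ i → f i , tabulate (f ∘ punchIn i)) (allFin (suc n)))
    ≡⟨ cong (concatMap _) (trans (map-tabulate id _) (sym (selections-tabulate f))) ⟩
  arrangements (suc n) (tabulate f) ∎
  where
  open ≡-Reasoning
  image = λ (π : Permutation′ (suc n)) → tabulate (f ∘ (π ⟨$⟩ʳ_))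

  starting-with : ∀ i → map image (map (insert 0F i) (permutations n)) ≡
                        map (f i ∷_) (arrangements n (tabulate (f ∘ punchIn i)))
  starting-with i = trans (sym (map-∘ (permutations n))) (trans
    (map-∘ (permutations n))
    (cong (map (f i ∷_)) (permutations-arrangements n (f ∘ punchIn i))))

-- The rank function of the free product

∣p∪q∣+∣p∩q∣ : ∀ (p q : Subset n) → ∣ p ∪ q ∣ + ∣ p ∩ q ∣ ≡ ∣ p ∣ + ∣ q ∣
∣p∪q∣+∣p∩q∣ []            []            = refl
∣p∪q∣+∣p∩q∣ (inside ∷ p)  (inside ∷ q)  =
  cong suc (trans (+-suc _ _) (trans (cong suc (∣p∪q∣+∣p∩q∣ p q)) (sym (+-suc _ _))))
∣p∪q∣+∣p∩q∣ (inside ∷ p)  (outside ∷ q) = cong suc (∣p∪q∣+∣p∩q∣ p q)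
∣p∪q∣+∣p∩q∣ (outside ∷ p) (inside ∷ q)  = trans (cong suc (∣p∪q∣+∣p∩q∣ p q)) (sym (+-suc _ _))
∣p∪q∣+∣p∩q∣ (outside ∷ p) (outside ∷ q) = ∣p∪q∣+∣p∩q∣ p q

between : ∀ {p q : Subset n} {k} → p ⊆ q → ∣ p ∣ ≤ k → k ≤ ∣ q ∣ → ∃ λ s → p ⊆ s × s ⊆ q × ∣ s ∣ ≡ k
between {p = []} {[]} _ _ z≤n = [] , (λ ()) , (λ ()) , refl
between {p = inside ∷ p} {inside ∷ q} p⊆q (s≤s ≤k) (s≤s k≤)
  with s , p⊆s , s⊆q , ∣s∣ ← between (drop-∷-⊆ p⊆q) ≤k k≤ = inside ∷ s , in⊆in p⊆s , in⊆in s⊆q , cong suc ∣s∣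
between {p = inside ∷ p} {outside ∷ q} p⊆q _ _ with () ← p⊆q here
between {p = outside ∷ p} {outside ∷ q} p⊆q ≤k k≤
  with s , p⊆s , s⊆q , ∣s∣ ← between (drop-∷-⊆ p⊆q) ≤k k≤ = outside ∷ s , out⊆ p⊆s , out⊆ s⊆q , ∣s∣
between {p = outside ∷ p} {inside ∷ q} {k} p⊆q ≤k k≤ with k ≤? ∣ q ∣
... | yes k≤∣q∣ with s , p⊆s , s⊆q , ∣s∣ ← between (drop-∷-⊆ p⊆q) ≤k k≤∣q∣ =
  outside ∷ s , out⊆ p⊆s , out⊆ s⊆q , ∣s∣
-- Here `k` is forced to be `suc ∣ q ∣`, so the whole upper set is taken.
... | no  k≰∣q∣ = inside ∷ q , p⊆q , ⊆-refl , ≤-antisym (≰⇒> k≰∣q∣) k≤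

∣p++q∣ : ∀ (p : Subset m) (q : Subset n) → ∣ p ++ᵛ q ∣ ≡ ∣ p ∣ + ∣ q ∣
∣p++q∣ {m = m} p q = trans (sym (∣take∣+∣drop∣ m (p ++ᵛ q)))
  (cong₂ _+_ (cong ∣_∣ (take-++ p q)) (cong ∣_∣ (drop-++ p q)))

⊆-++⇒take-⊆ : ∀ {s} (p : Subset m) (q : Subset n) → s ⊆ p ++ᵛ q → take m s ⊆ p
⊆-++⇒take-⊆ p q s⊆ {x} x∈ = subst (x ∈_) (take-++ p q) (∈-take⁺ (s⊆ (∈-take⁻ x∈)))

⊆-++⇒drop-⊆ : ∀ {s} (p : Subset m) (q : Subset n) → s ⊆ p ++ᵛ q → drop m s ⊆ q
⊆-++⇒drop-⊆ {m = m} p q s⊆ {x} x∈ = subst (x ∈_) (drop-++ p q) (∈-drop⁺ m (s⊆ (∈-drop⁻ m x∈)))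

++-mono-⊆ : ∀ {p p′ : Subset m} {q q′ : Subset n} → p ⊆ p′ → q ⊆ q′ → p ++ᵛ q ⊆ p′ ++ᵛ q′
++-mono-⊆ {p = []}    {[]}     p⊆ q⊆ = q⊆
++-mono-⊆ {p = s ∷ p} {t ∷ p′} p⊆ q⊆ here with here ← p⊆ here = here
++-mono-⊆ {p = s ∷ p} {t ∷ p′} p⊆ q⊆ (there x∈) = there (++-mono-⊆ (drop-∷-⊆ p⊆) q⊆ x∈)

rank≤∣∣ : ∀ (M : Matroid n r) X → rank M X ≤ ∣ X ∣
rank≤∣∣ M X with I , _ , I⊆X , ∣I∣ ← rank-attained M X = subst (_≤ ∣ X ∣) ∣I∣ (p⊆q⇒∣p∣≤∣q∣ I⊆X)

rank≤r : ∀ (M : Matroid n r) X → rank M X ≤ r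
rank≤r M X with I , (B , basis-B , I⊆B) , _ , ∣I∣ ← rank-attained M X =
  subst (_≤ _) ∣I∣ (subst (∣ I ∣ ≤_) (Matroid.size M basis-B) (p⊆q⇒∣p∣≤∣q∣ I⊆B))

module _ (M₁ : Matroid n₁ r₁) (M₂ : Matroid n₂ r₂) (X₁ : Subset n₁) (X₂ : Subset n₂) where
  private
    module M₁ = Matroid M₁
    module M₂ = Matroid M₂

  -- Take a largest independent `I` inside a basis `B`, and a basis `D` of `M₂` inside `B₂`. The
  -- part `I₂ ∩ D` is independent in `M₂`, so it has at most r₂(X₂) elements; the rest of `I` lies
  -- in `B₁` together with `B₂ ─ D`, which has |B| - r₂ = r₁ elements.
  rank-□-≤ˡ : rank (M₁ □ M₂) (X₁ ++ᵛ X₂) ≤ r₁ + rank M₂ X₂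
  rank-□-≤ˡ with rank-attained (M₁ □ M₂) (X₁ ++ᵛ X₂)
  ... | I , (B , (∣B∣ , (C , basis-C , B₁⊆C) , D , basis-D , D⊆B₂) , I⊆B) , I⊆X , ∣I∣ = begin
    rank (M₁ □ M₂) (X₁ ++ᵛ X₂)                 ≡⟨ ∣I∣ ⟨
    ∣ I ∣                                      ≡⟨ ∣take∣+∣drop∣ n₁ I ⟨
    ∣ I₁ ∣ + ∣ I₂ ∣                            ≡⟨ cong (∣ I₁ ∣ +_) (∣q∣≡∣p∣+∣q─p∣ (p∩q⊆p I₂ D)) ⟩
    ∣ I₁ ∣ + (∣ I₂ ∩ D ∣ + ∣ I₂ ─ (I₂ ∩ D) ∣)  ≡⟨ cong (∣ I₁ ∣ +_) (+-comm (∣ I₂ ∩ D ∣) _) ⟩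
    ∣ I₁ ∣ + (∣ I₂ ─ (I₂ ∩ D) ∣ + ∣ I₂ ∩ D ∣)  ≡⟨ +-assoc (∣ I₁ ∣) _ _ ⟨
    ∣ I₁ ∣ + ∣ I₂ ─ (I₂ ∩ D) ∣ + ∣ I₂ ∩ D ∣    ≤⟨ +-mono-≤ (+-mono-≤ (p⊆q⇒∣p∣≤∣q∣ I₁⊆B₁) (p⊆q⇒∣p∣≤∣q∣ I₂─D⊆B₂─D)) ∣I₂∩D∣≤ ⟩
    ∣ B₁ ∣ + ∣ B₂ ─ D ∣ + rank M₂ X₂           ≡⟨ cong (_+ rank M₂ X₂) ∣B₁∣+∣B₂─D∣ ⟩
    r₁ + rank M₂ X₂                            ∎
    where
    open ≤-Reasoning
    I₁ = take n₁ I
    I₂ = drop n₁ I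
    B₁ = take n₁ B
    B₂ = drop n₁ B

    I₁⊆B₁ : I₁ ⊆ B₁
    I₁⊆B₁ x∈ = ∈-take⁺ (I⊆B (∈-take⁻ x∈))

    I₂─D⊆B₂─D : I₂ ─ (I₂ ∩ D) ⊆ B₂ ─ D
    I₂─D⊆B₂─D x∈ with x∈I₂ , x∉ ← ∈-─⁻ I₂ (I₂ ∩ D) x∈ =
      x∈p∧x∉q⇒x∈p─q (∈-drop⁺ n₁ (I⊆B (∈-drop⁻ n₁ x∈I₂))) λ x∈D → x∉ (x∈p∩q⁺ (x∈I₂ , x∈D))

    ∣I₂∩D∣≤ : ∣ I₂ ∩ D ∣ ≤ rank M₂ X₂
    ∣I₂∩D∣≤ = ∣independent∣≤rank M₂ (D , basis-D , p∩q⊆q I₂ D) (⊆-++⇒drop-⊆ X₁ X₂ I⊆X ∘ p∩q⊆p I₂ D)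

    ∣B₁∣+∣B₂─D∣ : ∣ B₁ ∣ + ∣ B₂ ─ D ∣ ≡ r₁
    ∣B₁∣+∣B₂─D∣ = +-cancelʳ-≡ r₂ _ _ (trans (+-assoc (∣ B₁ ∣) _ r₂) (trans
      (cong (∣ B₁ ∣ +_) (trans (+-comm _ r₂) (trans
        (cong (_+ ∣ B₂ ─ D ∣) (sym (M₂.size basis-D))) (sym (∣q∣≡∣p∣+∣q─p∣ D⊆B₂)))))
      (trans (∣take∣+∣drop∣ n₁ B) ∣B∣)))

  rank-□-≤ʳ : rank (M₁ □ M₂) (X₁ ++ᵛ X₂) ≤ rank M₁ X₁ + ∣ X₂ ∣
  rank-□-≤ʳ with rank-attained (M₁ □ M₂) (X₁ ++ᵛ X₂)
  ... | I , (B , (∣B∣ , indep , _) , I⊆B) , I⊆X , ∣I∣ = begin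
    rank (M₁ □ M₂) (X₁ ++ᵛ X₂)       ≡⟨ ∣I∣ ⟨
    ∣ I ∣                            ≡⟨ ∣take∣+∣drop∣ n₁ I ⟨
    ∣ take n₁ I ∣ + ∣ drop n₁ I ∣    ≤⟨ +-mono-≤
      (∣independent∣≤rank M₁ (independent-⊆ M₁ (λ x∈ → ∈-take⁺ (I⊆B (∈-take⁻ x∈))) indep) (⊆-++⇒take-⊆ X₁ X₂ I⊆X))
      (p⊆q⇒∣p∣≤∣q∣ (⊆-++⇒drop-⊆ X₁ X₂ I⊆X)) ⟩
    rank M₁ X₁ + ∣ X₂ ∣              ∎
    where open ≤-Reasoning

  -- The independent set of M₁ □ M₂ is J₁ ∪ I₂; it lies in the basis
  -- B₁ ∪ I₂ ∪ D, where D is a basis of M₂ containing J₂.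
  ≤rank-□ : ∀ {J₁ B₁ J₂ I₂} → J₁ ⊆ X₁ → J₁ ⊆ B₁ → M₁.Independent B₁ →
            M₂.Independent J₂ → ∣ J₂ ∣ ≡ rank M₂ X₂ → J₂ ⊆ I₂ → I₂ ⊆ X₂ →
            ∣ B₁ ∣ + ∣ I₂ ∣ ≡ r₁ + rank M₂ X₂ →
            ∣ J₁ ∣ + ∣ I₂ ∣ ≤ rank (M₁ □ M₂) (X₁ ++ᵛ X₂)
  ≤rank-□ {J₁} {B₁} {J₂} {I₂} J₁⊆X₁ J₁⊆B₁ indep-B₁ (D , basis-D , J₂⊆D) ∣J₂∣ J₂⊆I₂ I₂⊆X₂ sizes =
    subst (_≤ _) (∣p++q∣ J₁ I₂) (∣independent∣≤rank (M₁ □ M₂)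
      (B₁ ++ᵛ (I₂ ∪ D) ,
        ( trans (∣p++q∣ B₁ (I₂ ∪ D)) ∣basis∣
        , subst M₁.Independent (sym (take-++ B₁ (I₂ ∪ D))) indep-B₁
        , D , basis-D , subst (D ⊆_) (sym (drop-++ B₁ (I₂ ∪ D))) (q⊆p∪q I₂ D)) ,
        ++-mono-⊆ J₁⊆B₁ (p⊆p∪q {p = I₂} D))
      (++-mono-⊆ J₁⊆X₁ I₂⊆X₂))
    where
    open ≡-Reasoning

    -- `I₂ ∩ D` is independent and contains `J₂`, which already has the largest possible size in
    -- `X₂`.
    ∣I₂∩D∣ : ∣ I₂ ∩ D ∣ ≡ rank M₂ X₂
    ∣I₂∩D∣ = ≤-antisym
      (∣independent∣≤rank M₂ (D , basis-D , p∩q⊆q I₂ D) (I₂⊆X₂ ∘ p∩q⊆p I₂ D))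
      (subst (_≤ _) ∣J₂∣ (p⊆q⇒∣p∣≤∣q∣ λ x∈ → x∈p∩q⁺ (J₂⊆I₂ x∈ , J₂⊆D x∈)))

    ∣basis∣ : ∣ B₁ ∣ + ∣ I₂ ∪ D ∣ ≡ r₁ + r₂
    ∣basis∣ = +-cancelʳ-≡ (rank M₂ X₂) _ _ (begin
      ∣ B₁ ∣ + ∣ I₂ ∪ D ∣ + rank M₂ X₂     ≡⟨ cong (∣ B₁ ∣ + ∣ I₂ ∪ D ∣ +_) ∣I₂∩D∣ ⟨
      ∣ B₁ ∣ + ∣ I₂ ∪ D ∣ + ∣ I₂ ∩ D ∣     ≡⟨ +-assoc (∣ B₁ ∣) _ _ ⟩
      ∣ B₁ ∣ + (∣ I₂ ∪ D ∣ + ∣ I₂ ∩ D ∣)   ≡⟨ cong (∣ B₁ ∣ +_) (∣p∪q∣+∣p∩q∣ I₂ D) ⟩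
      ∣ B₁ ∣ + (∣ I₂ ∣ + ∣ D ∣)            ≡⟨ +-assoc (∣ B₁ ∣) _ _ ⟨
      ∣ B₁ ∣ + ∣ I₂ ∣ + ∣ D ∣              ≡⟨ cong₂ _+_ sizes (M₂.size basis-D) ⟩
      r₁ + rank M₂ X₂ + r₂                 ≡⟨ +-assoc r₁ _ r₂ ⟩
      r₁ + (rank M₂ X₂ + r₂)               ≡⟨ cong (r₁ +_) (+-comm _ r₂) ⟩
      r₁ + (r₂ + rank M₂ X₂)               ≡⟨ +-assoc r₁ r₂ _ ⟨
      r₁ + r₂ + rank M₂ X₂                 ∎)

  -- The size equation of `≤rank-□` dictates the choice. If r₁ + r₂(X₂) is the minimum, `J₁` also
  -- serves as `B₁`, and `I₂` is cut down from `X₂` to r₁ + r₂(X₂) - r₁(X₁) elements. Otherwise `I₂`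
  -- is all of `X₂`, and `J₁` is enlarged inside a basis to a `B₁` with r₁ + r₂(X₂) - |X₂| elements.
  rank-□-≥ : (r₁ + rank M₂ X₂) ⊓ (rank M₁ X₁ + ∣ X₂ ∣) ≤ rank (M₁ □ M₂) (X₁ ++ᵛ X₂)
  rank-□-≥ with J₁ , indep-J₁ , J₁⊆X₁ , ∣J₁∣ ← rank-attained M₁ X₁
           with J₂ , indep-J₂ , J₂⊆X₂ , ∣J₂∣ ← rank-attained M₂ X₂
           with ≤-total (r₁ + rank M₂ X₂) (rank M₁ X₁ + ∣ X₂ ∣)
  ... | inj₁ ≤ˡ with I₂ , J₂⊆I₂ , I₂⊆X₂ , ∣I₂∣ ← between J₂⊆X₂
          (≤-trans (≤-reflexive ∣J₂∣) (m+n≤o⇒m≤o∸n (rank M₂ X₂)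
            (subst (rank M₂ X₂ + rank M₁ X₁ ≤_) (+-comm _ r₁) (+-monoʳ-≤ (rank M₂ X₂) (rank≤r M₁ X₁)))))
          (m≤n+o⇒m∸n≤o _ (rank M₁ X₁) ≤ˡ)
    = ≤-trans (m⊓n≤m _ _) (≤-trans (≤-reflexive (sym sizes))
        (≤rank-□ J₁⊆X₁ ⊆-refl indep-J₁ indep-J₂ ∣J₂∣ J₂⊆I₂ I₂⊆X₂ sizes))
    where
    sizes : ∣ J₁ ∣ + ∣ I₂ ∣ ≡ r₁ + rank M₂ X₂
    sizes = trans (cong₂ _+_ ∣J₁∣ ∣I₂∣) (m+[n∸m]≡n (≤-trans (rank≤r M₁ X₁) (m≤m+n r₁ _)))
  ... | inj₂ ≤ʳ with C , basis-C , J₁⊆C ← indep-J₁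
    with B₁ , J₁⊆B₁ , B₁⊆C , ∣B₁∣ ← between J₁⊆C
          (≤-trans (≤-reflexive ∣J₁∣) (m+n≤o⇒m≤o∸n (rank M₁ X₁) ≤ʳ))
          (≤-trans (m≤n+o⇒m∸n≤o _ (∣ X₂ ∣) (≤-trans (≤-reflexive (+-comm r₁ _)) (+-monoˡ-≤ r₁ (rank≤∣∣ M₂ X₂))))
            (≤-reflexive (sym (M₁.size basis-C))))
    = ≤-trans (m⊓n≤n _ _) (≤-trans (≤-reflexive (cong (_+ ∣ X₂ ∣) (sym ∣J₁∣)))
        (≤rank-□ J₁⊆X₁ J₁⊆B₁ (C , basis-C , B₁⊆C) indep-J₂ ∣J₂∣ J₂⊆X₂ ⊆-refl sizes))
    where
    sizes : ∣ B₁ ∣ + ∣ X₂ ∣ ≡ r₁ + rank M₂ X₂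
    sizes = trans (cong (_+ ∣ X₂ ∣) ∣B₁∣) (m∸n+n≡m (≤-trans (m≤n+m (∣ X₂ ∣) (rank M₁ X₁)) ≤ʳ))

  rank-□ : rank (M₁ □ M₂) (X₁ ++ᵛ X₂) ≡ (r₁ + rank M₂ X₂) ⊓ (rank M₁ X₁ + ∣ X₂ ∣)
  rank-□ = ≤-antisym (⊓-glb rank-□-≤ˡ rank-□-≤ʳ) rank-□-≥

-- Rank words along orderings given as lists

rankSteps : Matroid n r → Subset n → List (Fin n) → List ℕ
rankSteps M X []       = []
rankSteps M X (x ∷ xs) = rank M (X ∪ ⁅ x ⁆) ∸ rank M X ∷ rankSteps M (X ∪ ⁅ x ⁆) xs

-- Stated for any chain of sets growing by one named element at a time, since dropping the first set
-- from the prefixes of a permutation does not leave the prefixes of a permutation.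
rankSteps-chain : ∀ (M : Matroid n r) k (X : ℕ → Subset n) (x : Fin k → Fin n) →
                  (∀ i → X (suc (toℕ i)) ≡ X (toℕ i) ∪ ⁅ x i ⁆) →
                  toList (Vec.tabulate {n = k} λ i → rank M (X (suc (toℕ i))) ∸ rank M (X (toℕ i))) ≡
                  rankSteps M (X 0) (tabulate x)
rankSteps-chain M zero    X x step = refl
rankSteps-chain M (suc k) X x step = cong₂ _∷_
  (cong (λ Y → rank M Y ∸ rank M (X 0)) (step zero))
  (trans (rankSteps-chain M k (X ∘ suc) (x ∘ suc) (step ∘ suc))
    (cong (λ Y → rankSteps M Y (tabulate (x ∘ suc))) (step zero)))

prefix-zero : ∀ (π : Permutation′ n) → prefix π 0 ≡ ⊥
prefix-zero π = ⊆-antisym (λ e∈ → contradiction (∈-prefix⁻ π {0} e∈) λ ()) (⊆-min _)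

prefix-suc : ∀ (π : Permutation′ n) i → prefix π (suc (toℕ i)) ≡ prefix π (toℕ i) ∪ ⁅ π ⟨$⟩ʳ i ⁆
prefix-suc π i = ⊆-antisym to from
  where
  to : prefix π (suc (toℕ i)) ⊆ prefix π (toℕ i) ∪ ⁅ π ⟨$⟩ʳ i ⁆
  to {e} e∈ with toℕ (π ⟨$⟩ˡ e) ≟ toℕ i
  ... | yes eq = q⊆p∪q _ _ (subst (_∈ ⁅ π ⟨$⟩ʳ i ⁆)
                   (trans (cong (π ⟨$⟩ʳ_) (sym (toℕ-injective eq))) (inverseʳ π)) (x∈⁅x⁆ _))
  ... | no ≢i  = p⊆p∪q _ (∈-prefix⁺ π (≤∧≢⇒< (≤-pred (∈-prefix⁻ π e∈)) ≢i))

  from : prefix π (toℕ i) ∪ ⁅ π ⟨$⟩ʳ i ⁆ ⊆ prefix π (suc (toℕ i))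
  from e∈ with x∈p∪q⁻ (prefix π (toℕ i)) _ e∈
  ... | inj₁ e∈π = ∈-prefix⁺ π (m<n⇒m<1+n (∈-prefix⁻ π e∈π))
  ... | inj₂ e∈i with refl ← x∈⁅y⁆⇒x≡y _ e∈i = ∈-prefix⁺ π (s≤s (≤-reflexive (cong toℕ (inverseˡ π))))

rankWord≡rankSteps : ∀ (M : Matroid n r) π → toList (rankWord M π) ≡ rankSteps M ⊥ (tabulate (π ⟨$⟩ʳ_))
rankWord≡rankSteps {n = n} M π = trans
  (rankSteps-chain M n (prefix π) (π ⟨$⟩ʳ_) (prefix-suc π))
  (cong (λ X → rankSteps M X (tabulate (π ⟨$⟩ʳ_))) (prefix-zero π))

rankWords : Matroid n r → List (List ℕ)
rankWords {n} M = map (toList ∘ rankWord M) (permutations n)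

rankWords-arrangements : ∀ (M : Matroid n r) → rankWords M ≡ map (rankSteps M ⊥) (arrangements n (allFin n))
rankWords-arrangements {n = n} M = trans (map-cong (rankWord≡rankSteps M) (permutations n))
  (trans (map-∘ (permutations n)) (cong (map (rankSteps M ⊥)) (permutations-arrangements n id)))

-- Every arrangement lists the values of a permutation, which is injective. This will ensure that
-- |X₂| grows by exactly one with each element of the second ground set.
arrangements-Unique : ∀ n → All Unique (arrangements n (allFin n))
arrangements-Unique n = subst (All Unique) (permutations-arrangements n id)
  (All.map⁺ (All.universal (λ π → Unique.tabulate⁺ λ eq →
    trans (sym (inverseˡ π)) (trans (cong (π ⟨$⟩ˡ_) eq) (inverseˡ π))) (permutations n)))

-- Rank words of the free product as shuffles of rank words

allFin-+ : ∀ m n → allFin (m + n) ≡ map (_↑ˡ n) (allFin m) ++ map (m ↑ʳ_) (allFin n)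
allFin-+ zero    n = sym (map-tabulate id id)
allFin-+ (suc m) n = cong (zero ∷_) (begin
  tabulate suc                                                            ≡⟨ map-tabulate id suc ⟨
  map suc (allFin (m + n))                                                ≡⟨ cong (map suc) (allFin-+ m n) ⟩
  map suc (map (_↑ˡ n) (allFin m) ++ map (m ↑ʳ_) (allFin n))              ≡⟨ map-++ suc (map (_↑ˡ n) (allFin m)) _ ⟩
  map suc (map (_↑ˡ n) (allFin m)) ++ map suc (map (m ↑ʳ_) (allFin n))    ≡⟨ cong₂ _++_
    (trans (sym (map-∘ (allFin m))) (trans (map-tabulate id _) (sym (map-tabulate suc _))))
    (sym (map-∘ (allFin n))) ⟩
  map (_↑ˡ n) (tabulate suc) ++ map (suc m ↑ʳ_) (allFin n)                ∎)
  where open ≡-Reasoning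

⊥-++ : ∀ m {n} → ⊥ {n = m + n} ≡ ⊥ {n = m} ++ᵛ ⊥
⊥-++ zero    = refl
⊥-++ (suc m) = cong (outside ∷_) (⊥-++ m)

++-∪-↑ˡ : ∀ (p : Subset m) (q : Subset n) x → (p ++ᵛ q) ∪ ⁅ x ↑ˡ n ⁆ ≡ (p ∪ ⁅ x ⁆) ++ᵛ q
++-∪-↑ˡ (s ∷ p) q zero    = cong (_ ∷_) (trans (∪-identityʳ _) (cong (_++ᵛ q) (sym (∪-identityʳ p))))
++-∪-↑ˡ (s ∷ p) q (suc x) = cong (_ ∷_) (++-∪-↑ˡ p q x)

++-∪-↑ʳ : ∀ (p : Subset m) (q : Subset n) x → (p ++ᵛ q) ∪ ⁅ m ↑ʳ x ⁆ ≡ p ++ᵛ (q ∪ ⁅ x ⁆)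
++-∪-↑ʳ []            q x = refl
++-∪-↑ʳ (inside  ∷ p) q x = cong (_ ∷_) (++-∪-↑ʳ p q x)
++-∪-↑ʳ (outside ∷ p) q x = cong (_ ∷_) (++-∪-↑ʳ p q x)

-- The right-hand side of `rank-□` as a function of numbers alone.
freeRank : ℕ → ℕ → ℕ → ℕ → ℕ
freeRank r₁ a b c = (r₁ + b) ⊓ (a + c)

-- The rank word of M₁ □ M₂ along an ordering, computed from the entries of
-- the words of M₁ (tagged inj₁) and M₂ (tagged inj₂) in that ordering; a, b
-- and c are the current values of r₁(X₁), r₂(X₂) and |X₂|.
freeSteps : ℕ → ℕ → ℕ → ℕ → List (ℕ ⊎ ℕ) → List ℕ
freeSteps r₁ a b c []           = []
freeSteps r₁ a b c (inj₁ d ∷ w) =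
  freeRank r₁ (a + d) b c ∸ freeRank r₁ a b c ∷ freeSteps r₁ (a + d) b c w
freeSteps r₁ a b c (inj₂ d ∷ w) =
  freeRank r₁ a (b + d) (suc c) ∸ freeRank r₁ a b c ∷ freeSteps r₁ a (b + d) (suc c) w

rank-∪ : ∀ (M : Matroid n r) X Y → rank M X + (rank M (X ∪ Y) ∸ rank M X) ≡ rank M (X ∪ Y)
rank-∪ M X Y = m+[n∸m]≡n (rank-mono M (p⊆p∪q {p = X} Y))

-- The common pattern of `consˡ` and `consʳ`: on reading `x` and `y`, two scanners `f` and `g` emit
-- the same letter `z` and continue as `f′` and `g′`.
map-map-∷ : ∀ {f f′ : List A → List C} {g g′ : List B → List C} {x y z} →
            (∀ w → f (x ∷ w) ≡ z ∷ f′ w) → (∀ w → g (y ∷ w) ≡ z ∷ g′ w) →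
            ∀ {ws ws′} → map f′ ws ≡ map g′ ws′ → map f (map (x ∷_) ws) ≡ map g (map (y ∷_) ws′)
map-map-∷ {f = f} {f′} {g} {g′} {x} {y} {z} f-∷ g-∷ {ws} {ws′} eq = begin
  map f (map (x ∷_) ws)     ≡⟨ trans (sym (map-∘ ws)) (trans (map-cong f-∷ ws) (map-∘ ws)) ⟩
  map (z ∷_) (map f′ ws)    ≡⟨ cong (map (z ∷_)) eq ⟩
  map (z ∷_) (map g′ ws′)   ≡⟨ trans (sym (map-∘ ws′)) (trans (map-cong (sym ∘ g-∷) ws′) (map-∘ ws′)) ⟩
  map g (map (y ∷_) ws′)    ∎
  where open ≡-Reasoning

map-⧢ : ∀ (f : List B → C) (g : A → List B) (h : D → List B) uss vss →
        map f (map g uss ⧢ map h vss) ≡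
        concatMap (λ us → concatMap (λ vs → map f (shuffles (g us) (h vs))) vss) uss
map-⧢ f g h uss vss = begin
  map f (map g uss ⧢ map h vss)
    ≡⟨ cong (map f) (concatMap-map (λ us → concatMap (shuffles us) (map h vss)) g uss) ⟩
  map f (concatMap (λ us → concatMap (shuffles (g us)) (map h vss)) uss)
    ≡⟨ map-concatMap f _ uss ⟩
  concatMap (λ us → map f (concatMap (shuffles (g us)) (map h vss))) uss
    ≡⟨ concatMap-cong (λ us → trans (cong (map f) (concatMap-map (shuffles (g us)) h vss))
         (map-concatMap f _ vss)) uss ⟩
  concatMap (λ us → concatMap (λ vs → map f (shuffles (g us) (h vs))) vss) uss ∎
  where open ≡-Reasoning

module _ (M₁ : Matroid n₁ r₁) (M₂ : Matroid n₂ r₂) where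

  private
    freeStepsFrom : Subset n₁ → Subset n₂ → List (ℕ ⊎ ℕ) → List ℕ
    freeStepsFrom X₁ X₂ = freeSteps r₁ (rank M₁ X₁) (rank M₂ X₂) ∣ X₂ ∣

    freeRankOf : Subset n₁ → Subset n₂ → ℕ
    freeRankOf X₁ X₂ = freeRank r₁ (rank M₁ X₁) (rank M₂ X₂) ∣ X₂ ∣

    step : Subset n₁ → Subset n₂ → Subset n₁ → Subset n₂ → ℕ
    step X₁ X₂ Y₁ Y₂ = freeRankOf Y₁ Y₂ ∸ freeRankOf X₁ X₂

    rankSteps-∷ : ∀ X₁ X₂ Y₁ Y₂ z → (X₁ ++ᵛ X₂) ∪ ⁅ z ⁆ ≡ Y₁ ++ᵛ Y₂ → ∀ w →
                  rankSteps (M₁ □ M₂) (X₁ ++ᵛ X₂) (z ∷ w) ≡ step X₁ X₂ Y₁ Y₂ ∷ rankSteps (M₁ □ M₂) (Y₁ ++ᵛ Y₂) w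
    rankSteps-∷ X₁ X₂ Y₁ Y₂ z eq w = cong₂ _∷_
      (cong₂ _∸_ (trans (cong (rank (M₁ □ M₂)) eq) (rank-□ M₁ M₂ Y₁ Y₂)) (rank-□ M₁ M₂ X₁ X₂))
      (cong (λ Y → rankSteps (M₁ □ M₂) Y w) eq)

    freeSteps-∷ˡ : ∀ X₁ X₂ x w →
      freeStepsFrom X₁ X₂ (inj₁ (rank M₁ (X₁ ∪ ⁅ x ⁆) ∸ rank M₁ X₁) ∷ w) ≡
      step X₁ X₂ (X₁ ∪ ⁅ x ⁆) X₂ ∷ freeStepsFrom (X₁ ∪ ⁅ x ⁆) X₂ w
    freeSteps-∷ˡ X₁ X₂ x w = cong
      (λ a → freeRank r₁ a (rank M₂ X₂) ∣ X₂ ∣ ∸ freeRankOf X₁ X₂ ∷ freeSteps r₁ a (rank M₂ X₂) ∣ X₂ ∣ w)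
      (rank-∪ M₁ X₁ ⁅ x ⁆)

    freeSteps-∷ʳ : ∀ X₁ X₂ {y} → y ∉ X₂ → ∀ w →
      freeStepsFrom X₁ X₂ (inj₂ (rank M₂ (X₂ ∪ ⁅ y ⁆) ∸ rank M₂ X₂) ∷ w) ≡
      step X₁ X₂ X₁ (X₂ ∪ ⁅ y ⁆) ∷ freeStepsFrom X₁ (X₂ ∪ ⁅ y ⁆) w
    freeSteps-∷ʳ X₁ X₂ {y} y∉ w = cong₂
      (λ b c → freeRank r₁ (rank M₁ X₁) b c ∸ freeRankOf X₁ X₂ ∷ freeSteps r₁ (rank M₁ X₁) b c w)
      (rank-∪ M₂ X₂ ⁅ y ⁆) (sym (∣insert∣ X₂ y∉))

    -- `freeSteps` adds one to its counter for every letter of the second word; the counter agrees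
    -- with |X₂| as long as each element read is new.
    Fresh : Subset n₂ → List (Fin n₂) → Set
    Fresh X₂ vs = Unique vs × All (_∉ X₂) vs

    fresh-tail : ∀ {X₂ v vs} → Fresh X₂ (v ∷ vs) → Fresh (X₂ ∪ ⁅ v ⁆) vs
    fresh-tail {X₂} {v} (v≢vs ∷ unique , _ ∷ vs∉) = unique ,
      All.zipWith (λ (v≢w , w∉) w∈ → [ w∉ , (λ w∈v → v≢w (sym (x∈⁅y⁆⇒x≡y v w∈v))) ]′ (x∈p∪q⁻ X₂ ⁅ v ⁆ w∈)) (v≢vs , vs∉)

  -- Both sides run through the shuffles in the same order, hence an equality of lists. The left
  -- side carries the sets X₁ and X₂, the right side only r₁(X₁), r₂(X₂) and |X₂|; by `rank-□` these
  -- numbers determine the letter emitted. The induction needs arbitrary starting sets.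
  rankSteps-shuffles : ∀ X₁ X₂ us vs → Fresh X₂ vs →
    map (rankSteps (M₁ □ M₂) (X₁ ++ᵛ X₂)) (shuffles (map (_↑ˡ n₂) us) (map (n₁ ↑ʳ_) vs)) ≡
    map (freeStepsFrom X₁ X₂) (shuffles (map inj₁ (rankSteps M₁ X₁ us)) (map inj₂ (rankSteps M₂ X₂ vs)))

  private
    consˡ : ∀ X₁ X₂ u {us} vs → Fresh X₂ vs →
      map (rankSteps (M₁ □ M₂) (X₁ ++ᵛ X₂)) (map ((u ↑ˡ n₂) ∷_) (shuffles (map (_↑ˡ n₂) us) (map (n₁ ↑ʳ_) vs))) ≡
      map (freeStepsFrom X₁ X₂) (map (inj₁ (rank M₁ (X₁ ∪ ⁅ u ⁆) ∸ rank M₁ X₁) ∷_)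
        (shuffles (map inj₁ (rankSteps M₁ (X₁ ∪ ⁅ u ⁆) us)) (map inj₂ (rankSteps M₂ X₂ vs))))
    consˡ X₁ X₂ u {us} vs fresh = map-map-∷
      (rankSteps-∷ X₁ X₂ (X₁ ∪ ⁅ u ⁆) X₂ (u ↑ˡ n₂) (++-∪-↑ˡ X₁ X₂ u)) (freeSteps-∷ˡ X₁ X₂ u)
      (rankSteps-shuffles (X₁ ∪ ⁅ u ⁆) X₂ us vs fresh)

    consʳ : ∀ X₁ X₂ us {v vs} → Fresh X₂ (v ∷ vs) →
      map (rankSteps (M₁ □ M₂) (X₁ ++ᵛ X₂)) (map ((n₁ ↑ʳ v) ∷_) (shuffles (map (_↑ˡ n₂) us) (map (n₁ ↑ʳ_) vs))) ≡
      map (freeStepsFrom X₁ X₂) (map (inj₂ (rank M₂ (X₂ ∪ ⁅ v ⁆) ∸ rank M₂ X₂) ∷_)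
        (shuffles (map inj₁ (rankSteps M₁ X₁ us)) (map inj₂ (rankSteps M₂ (X₂ ∪ ⁅ v ⁆) vs))))
    consʳ X₁ X₂ us {v} {vs} fresh = map-map-∷
      (rankSteps-∷ X₁ X₂ X₁ (X₂ ∪ ⁅ v ⁆) (n₁ ↑ʳ v) (++-∪-↑ʳ X₁ X₂ v)) (freeSteps-∷ʳ X₁ X₂ (All.head (proj₂ fresh)))
      (rankSteps-shuffles X₁ (X₂ ∪ ⁅ v ⁆) us vs (fresh-tail fresh))

  rankSteps-shuffles X₁ X₂ []       []       fresh = refl
  rankSteps-shuffles X₁ X₂ []       (v ∷ vs) fresh = consʳ X₁ X₂ [] fresh
  rankSteps-shuffles X₁ X₂ (u ∷ us) []       fresh = consˡ X₁ X₂ u {us} [] fresh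
  rankSteps-shuffles X₁ X₂ (u ∷ us) (v ∷ vs) fresh = trans
    (map-++ _ (map ((u ↑ˡ n₂) ∷_) (shuffles (map (_↑ˡ n₂) us) (map (n₁ ↑ʳ_) (v ∷ vs)))) _)
    (trans (cong₂ _++_ (consˡ X₁ X₂ u {us} (v ∷ vs) fresh) (consʳ X₁ X₂ (u ∷ us) fresh))
      (sym (map-++ _ (map (inj₁ _ ∷_) (shuffles (map inj₁ (rankSteps M₁ (X₁ ∪ ⁅ u ⁆) us)) _)) _)))

  rankWords-□ : rankWords (M₁ □ M₂) ↭
                map (freeSteps r₁ 0 0 0) (map (map inj₁) (rankWords M₁) ⧢ map (map inj₂) (rankWords M₂))
  rankWords-□ = begin
    rankWords (M₁ □ M₂)
      ≡⟨ rankWords-arrangements (M₁ □ M₂) ⟩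
    map (rankSteps (M₁ □ M₂) ⊥) (arrangements (n₁ + n₂) (allFin (n₁ + n₂)))
      ≡⟨ cong₂ (λ X xs → map (rankSteps (M₁ □ M₂) X) (arrangements (n₁ + n₂) xs)) (⊥-++ n₁) (allFin-+ n₁ n₂) ⟩
    map orderedRanks (arrangements (n₁ + n₂) (map (_↑ˡ n₂) (allFin n₁) ++ map (n₁ ↑ʳ_) (allFin n₂)))
      ↭⟨ map⁺ orderedRanks (arrangements-++ n₁ n₂ _ _ (length-map-allFin (_↑ˡ n₂)) (length-map-allFin (n₁ ↑ʳ_))) ⟩
    map orderedRanks (arrangements n₁ (map (_↑ˡ n₂) (allFin n₁)) ⧢ arrangements n₂ (map (n₁ ↑ʳ_) (allFin n₂)))
      ≡⟨ cong (map orderedRanks) (cong₂ _⧢_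
           (arrangements-map (_↑ˡ n₂) n₁ (allFin n₁)) (arrangements-map (n₁ ↑ʳ_) n₂ (allFin n₂))) ⟩
    map orderedRanks (map (map (_↑ˡ n₂)) (arrangements n₁ (allFin n₁)) ⧢
                      map (map (n₁ ↑ʳ_)) (arrangements n₂ (allFin n₂)))
      ≡⟨ map-⧢ orderedRanks (map (_↑ˡ n₂)) (map (n₁ ↑ʳ_)) (arrangements n₁ (allFin n₁)) (arrangements n₂ (allFin n₂)) ⟩
    concatMap (λ us → concatMap (λ vs → map orderedRanks (shuffles (map (_↑ˡ n₂) us) (map (n₁ ↑ʳ_) vs)))
      (arrangements n₂ (allFin n₂))) (arrangements n₁ (allFin n₁))
      ↭⟨ concatMap-cong-↭ (λ us → concatMap-cong-All (All.map (λ {vs} unique → ↭-reflexive (from-⊥ us vs unique))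
           (arrangements-Unique n₂))) (arrangements n₁ (allFin n₁)) ⟩
    concatMap (λ us → concatMap (λ vs → map (freeSteps r₁ 0 0 0)
      (shuffles (map inj₁ (rankSteps M₁ ⊥ us)) (map inj₂ (rankSteps M₂ ⊥ vs))))
      (arrangements n₂ (allFin n₂))) (arrangements n₁ (allFin n₁))
      ≡⟨ map-⧢ (freeSteps r₁ 0 0 0) (map inj₁ ∘ rankSteps M₁ ⊥) (map inj₂ ∘ rankSteps M₂ ⊥)
           (arrangements n₁ (allFin n₁)) (arrangements n₂ (allFin n₂)) ⟨
    map (freeSteps r₁ 0 0 0) (map (map inj₁ ∘ rankSteps M₁ ⊥) (arrangements n₁ (allFin n₁)) ⧢
                              map (map inj₂ ∘ rankSteps M₂ ⊥) (arrangements n₂ (allFin n₂)))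
      ≡⟨ cong (map (freeSteps r₁ 0 0 0)) (cong₂ _⧢_
           (trans (map-∘ (arrangements n₁ (allFin n₁))) (cong (map (map inj₁)) (sym (rankWords-arrangements M₁))))
           (trans (map-∘ (arrangements n₂ (allFin n₂))) (cong (map (map inj₂)) (sym (rankWords-arrangements M₂))))) ⟩
    map (freeSteps r₁ 0 0 0) (map (map inj₁) (rankWords M₁) ⧢ map (map inj₂) (rankWords M₂)) ∎
    where
    open PermutationReasoning

    orderedRanks : List (Fin (n₁ + n₂)) → List ℕ
    orderedRanks = rankSteps (M₁ □ M₂) (⊥ {n₁} ++ᵛ ⊥)

    length-map-allFin : ∀ {k} (f : Fin k → Fin (n₁ + n₂)) → length (map f (allFin k)) ≡ k
    length-map-allFin f = trans (length-map f (allFin _)) (length-tabulate id)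

    from-⊥ : ∀ us vs → Unique vs →
      map orderedRanks (shuffles (map (_↑ˡ n₂) us) (map (n₁ ↑ʳ_) vs)) ≡
      map (freeSteps r₁ 0 0 0) (shuffles (map inj₁ (rankSteps M₁ ⊥ us)) (map inj₂ (rankSteps M₂ ⊥ vs)))
    from-⊥ us vs unique
      -- At the empty sets both ranks and the cardinality are 0, which is the initial state of
      -- `freeSteps`.
      with eq ← rankSteps-shuffles (⊥ {n₁}) ⊥ us vs (unique , All.universal (λ _ → ∉⊥) vs)
      rewrite rank-empty M₁ {⊥} id | rank-empty M₂ {⊥} id | ∣⊥∣≡0 n₂ = eq

⧢-↭ : ∀ {uss uss′ vss vss′ : List (List A)} → uss ↭ uss′ → vss ↭ vss′ → uss ⧢ vss ↭ uss′ ⧢ vss′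
⧢-↭ {uss′ = uss′} uss↭ vss↭ = ↭-trans (concatMap⁺ _ uss↭)
  (concatMap-cong-↭ (λ us → concatMap⁺ (shuffles us) vss↭) uss′)

rankWords-□-↭ : ∀ {M₁ M₁′ : Matroid n₁ r₁} {M₂ M₂′ : Matroid n₂ r₂} →
                rankWords M₁ ↭ rankWords M₁′ → rankWords M₂ ↭ rankWords M₂′ →
                rankWords (M₁ □ M₂) ↭ rankWords (M₁′ □ M₂′)
rankWords-□-↭ {M₁ = M₁} {M₁′} {M₂} {M₂′} words₁ words₂ = ↭-trans (rankWords-□ M₁ M₂) (↭-trans
  (map⁺ _ (⧢-↭ (map⁺ (map inj₁) words₁) (map⁺ (map inj₂) words₂)))
  (↭-sym (rankWords-□ M₁′ M₂′)))

-- Multisets and multiplicities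

module _ (_≟ᴬ_ : DecidableEquality A) where

  occurrences : A → List A → ℕ
  occurrences x = length ∘ filter (_≟ᴬ x)

  occurrences-↭ : ∀ x {xs ys} → xs ↭ ys → occurrences x xs ≡ occurrences x ys
  occurrences-↭ x xs↭ys = ↭-length (filter-↭ (_≟ᴬ x) xs↭ys)

  occurrences-head : ∀ x xs → ∃ λ k → occurrences x (x ∷ xs) ≡ suc k
  occurrences-head x xs with x ≟ᴬ x
  ... | yes _  = _ , refl
  ... | no x≢x = contradiction refl x≢x

  occurrences-suc⇒∈ : ∀ {x k} xs → occurrences x xs ≡ suc k → x ∈ˡ xs
  occurrences-suc⇒∈ {x} (y ∷ ys) eq with y ≟ᴬ x
  ... | yes refl = here refl
  ... | no  _      = there (occurrences-suc⇒∈ ys eq)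

  occurrences-tail : ∀ x y xs ys → occurrences x (y ∷ xs) ≡ occurrences x (y ∷ ys) → occurrences x xs ≡ occurrences x ys
  occurrences-tail x y xs ys eq with y ≟ᴬ x
  ... | yes _ = suc-injective eq
  ... | no  _ = eq

  -- The head of `xs` has positive multiplicity in `ys`, so it can be removed from both lists, which
  -- keeps all multiplicities equal. Only members are tested because in the application a
  -- multiplicity is known only for words of `Sequence`s, not for arbitrary lists of numbers.
  occurrences⇒↭ : ∀ xs ys → (∀ {x} → x ∈ˡ xs ⊎ x ∈ˡ ys → occurrences x xs ≡ occurrences x ys) → xs ↭ ys
  occurrences⇒↭ []       []       _  = ↭.refl
  occurrences⇒↭ []       (y ∷ ys) eq
    with _ , head ← occurrences-head y ys
    with () ← trans (eq (inj₂ (here refl))) head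
  occurrences⇒↭ (x ∷ xs) ys       eq with _ , head ← occurrences-head x xs
    with ys₁ , ys₂ , refl ← ∈-∃++ (occurrences-suc⇒∈ ys (trans (sym (eq (inj₁ (here refl)))) head)) =
    ↭-trans (prep x (occurrences⇒↭ xs (ys₁ ++ ys₂) λ {z} z∈ →
      occurrences-tail z x xs (ys₁ ++ ys₂) (trans
        (eq ([ inj₁ ∘ there , inj₂ ∘ ∈-resp-↭ (↭-sym x↭) ∘ there ]′ z∈))
        (occurrences-↭ z x↭))))
      (↭-sym x↭)
    where
    x↭ : ys₁ ++ x ∷ ys₂ ↭ x ∷ ys₁ ++ ys₂
    x↭ = shift x ys₁ ys₂

-- Coefficients of the invariant and characteristic zero

module _ {ℓ₁ ℓ₂ ℓ₃ : Level} (K : HeytingField ℓ₁ ℓ₂ ℓ₃) where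
  private module K = CommutativeRing (scalars K)
  open K using (_≈_; 0#; 1#)
  open MonoidMult K.+-monoid using (×-homo-+) renaming (_×_ to _·_)
  open RingProperties K.ring using (+-cancelˡ)

  private
    occ : List ℕ → List (List ℕ) → ℕ
    occ = occurrences (≡-decˡ _≟_)

  𝒢-coefficient : ∀ (M : Matroid n r) s → 𝒢 K M s ≈ occ (toList (Sequence.word s)) (rankWords M) · 1#
  𝒢-coefficient {n = n} M s = go (permutations n)
    where
    open Module (𝒢-space K n _) using (_+ᴹ_; 0ᴹ)
    t = Sequence.word s

    -- `symbol` compares words as vectors, `occ` as lists; the two tests have the same outcome.
    does-toList : ∀ w → does (≡-dec _≟_ w t) ≡ does (≡-decˡ _≟_ (toList w) (toList t))
    does-toList w = does-⇔ (mk⇔ (cong toList) λ eq →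
      trans (sym (cast-is-id refl w)) (toList-injective refl w t eq))
      (≡-dec _≟_ w t) (≡-decˡ _≟_ (toList w) (toList t))

    go : ∀ πs → foldr _+ᴹ_ 0ᴹ (map (λ π → symbol K (rankSequence M π)) πs) s ≈
                occ (toList t) (map (toList ∘ rankWord M) πs) · 1#
    go []       = K.refl
    go (π ∷ πs) rewrite does-toList (rankWord M π) with does (≡-decˡ _≟_ (toList (rankWord M π)) (toList t))
    ... | true  = K.+-congˡ (go πs)
    ... | false = K.trans (K.+-identityˡ _) (go πs)

  module _ (char-0 : CharacteristicZero K) where

    -- Writing n as m + (k + 1) and cancelling the m-fold sum of `1#` would leave a positive
    -- multiple of `1#` equal to `0#`.
    ·1-< : ∀ {m n} → m < n → ¬ (m · 1# ≈ n · 1#)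
    ·1-< {m} m<n eq with k , refl ← m≤n⇒∃[o]m+o≡n m<n =
      char-0 (suc k) (K.sym (+-cancelˡ (m · 1#) 0# (suc k · 1#) (K.trans (K.+-identityʳ _) (K.trans eq
        (K.trans (K.reflexive (cong (_· 1#) (sym (+-suc m k)))) (×-homo-+ 1# m (suc k)))))))

    ·1-injective : ∀ {m n} → m · 1# ≈ n · 1# → m ≡ n
    ·1-injective {m} {n} eq with <-cmp m n
    ... | tri< m<n _ _ = contradiction eq (·1-< m<n)
    ... | tri≈ _ m≡n _ = m≡n
    ... | tri> _ _ n<m = contradiction (K.sym eq) (·1-< n<m)

    -- Each member of either list is the word of an actual rank sequence; the coefficients at that
    -- sequence are the two multiplicities times `1#`, and `·1-injective` removes the factor.
    𝒢-≈⇒rankWords-↭ : ∀ (M M′ : Matroid n r) → (∀ s → 𝒢 K M s ≈ 𝒢 K M′ s) → rankWords M ↭ rankWords M′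
    𝒢-≈⇒rankWords-↭ M M′ eq =
      occurrences⇒↭ (≡-decˡ _≟_) (rankWords M) (rankWords M′) [ from-word M , from-word M′ ]′
      where
      from-word : ∀ N {w} → w ∈ˡ rankWords N → occ w (rankWords M) ≡ occ w (rankWords M′)
      from-word N w∈ with π , _ , refl ← ∈-map⁻ (toList ∘ rankWord N) w∈ = ·1-injective
        (K.trans (K.sym (𝒢-coefficient M s)) (K.trans (eq s) (𝒢-coefficient M′ s)))
        where s = rankSequence N π

  rankWords-↭⇒𝒢-≈ : ∀ (M M′ : Matroid n r) → rankWords M ↭ rankWords M′ → ∀ s → 𝒢 K M s ≈ 𝒢 K M′ s
  rankWords-↭⇒𝒢-≈ M M′ M↭M′ s = K.trans (𝒢-coefficient M s) (K.trans
    (K.reflexive (cong (_· 1#) (occurrences-↭ (≡-decˡ _≟_) (toList (Sequence.word s)) M↭M′))) (K.sym (𝒢-coefficient M′ s)))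

proposition4p11 :
  ∀ {c ℓ₁ ℓ₂ : Level} (K : HeytingField c ℓ₁ ℓ₂) → CharacteristicZero K →
    ∀ {n₁ r₁ n₂ r₂ : ℕ} (M₁ M₁′ : Matroid n₁ r₁) (M₂ M₂′ : Matroid n₂ r₂) →
    let open Module (𝒢-space K n₁ r₁) using () renaming (_≈ᴹ_ to _≈₁_)
        open Module (𝒢-space K n₂ r₂) using () renaming (_≈ᴹ_ to _≈₂_)
        open Module (𝒢-space K (n₁ + n₂) (r₁ + r₂)) using () renaming (_≈ᴹ_ to _≈_)
    in
    𝒢 K M₁′ ≈₁ 𝒢 K M₁ →
    𝒢 K M₂′ ≈₂ 𝒢 K M₂ →
    𝒢 K (M₁′ □ M₂′) ≈ 𝒢 K (M₁ □ M₂)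
proposition4p11 K char-0 M₁ M₁′ M₂ M₂′ eq₁ eq₂ = rankWords-↭⇒𝒢-≈ K (M₁′ □ M₂′) (M₁ □ M₂)
  (rankWords-□-↭ {M₁ = M₁′} {M₁} {M₂′} {M₂}
    (𝒢-≈⇒rankWords-↭ K char-0 M₁′ M₁ eq₁)
    (𝒢-≈⇒rankWords-↭ K char-0 M₂′ M₂ eq₂))
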